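{- There exists a constant $c>0$ such that for every sufficiently small $\epsilon>0$ and for infinitely many integers $n>0$ there is an instance $\mathcal{I}=(J,p,r,d)$ of $1|r_j,d_j|\sum_j p_jU'_j$ with $|J|=n$ jobs and $T:=\sum_{j\in J}p_j=\max_{j\in J}d_j$ such that: (i) every solution to $\mathcal{I}$ has cost at least $0.2T$; and (ii) $\mathrm{SA}(\mathcal{P}_{\mathcal{I}}(\epsilon T),\lfloor c\epsilon\log n\rfloor)\neq\emptyset$.
   Context: The problem $1|r_j,d_j|\sum_j p_jU'_j$: one machine and a set $J$ of jobs, each with size $p_j\in\mathbb{Z}_{>0}$, release time $r_j\in\mathbb{Z}_{\ge 0}$ and deadline $d_j\ge r_j+p_j$. A solution chooses for each job a length $p'_j\in[0,p_j]$ and, if $p'_j>0$, processes $j$ non-preemptively during an interval $(t,t+p'_j]\subseteq(r_j,d_j]$ with $t$ an integer, such that the processing intervals of different jobs are disjoint. Its cost is $\sum_{j\in J}(p_j-p'_j)$. The LP $\mathcal{P}_{\mathcal{I}}(B)$ has variables $x_{j,t,p'}$ for $j\in J$, $p'\in\{1,\dots,p_j\}$ and integer $t\in[r_j,d_j-p']$, and constraints: $\sum_j\big(p_j-\sum_{t,p'}x_{j,t,p'}\,p'\big)\le B$; $\sum_{t,p'}x_{j,t,p'}\le 1$ for all $j\in J$; $\sum_{(j,t,p'):\,t'\in(t,t+p']}x_{j,t,p'}\le 1$ for all $t'\in[T]$; $x_{j,t,p'}\ge 0$ for all variables. Sherali–Adams lift: for a linear system $\{\sum_i a_{k,i}x_i\le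 b_k\}_k$ over variable index set $V$ and an integer $r\ge 1$, $\mathrm{SA}(\mathcal{P},r)$ is the set of vectors $(x_S)_{S\subseteq V,|S|\le r}$ satisfying $x_\emptyset=1$ and, for every constraint $k$ and all $S,R\subseteq V$ with $|S|+|R|\le r-1$, the linearized constraint $\sum_{R'\subseteq R}(-1)^{|R'|}\big(\sum_{i}a_{k,i}\,x_{S\cup R'\cup\{i\}}-b_k\,x_{S\cup R'}\big)\le 0$.
   Formalization: The parameter ε ranges over rational numbers in (0, ε₀) instead of all real ones; the real case follows by passing to a slightly smaller rational ε and halving c. -}

module Defs where

open import Data.Nat as ℕ using (ℕ; zero; suc; _∸_; _⊔_; _^_)
open import Data.Fin as Fin using (Fin)
open import Relation.Nullary using (yes; no)
open import Data.Fin.Subset using (Subset; ⊥; ⁅_⁆; _∪_; ∣_∣; inside; outside)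
open import Data.Integer using (ℤ; +_)
import Data.Integer as ℤ
open import Data.Rational as ℚ using (ℚ; 0ℚ; 1ℚ; _/_; ↥_; ↧ₙ_)
open import Data.List as List using (List; []; _∷_; _++_; map; concatMap; allFin; upTo; foldr; length; lookup)
open import Data.Vec using (Vec; []; _∷_)
open import Data.Product using (_×_; _,_; proj₁; proj₂; Σ; ∃)
open import Data.Sum using (_⊎_)
open import Relation.Binary.PropositionalEquality using (_≡_; _≢_)

sumFinℕ : ∀ {n} → (Fin n → ℕ) → ℕ
sumFinℕ {n} f = foldr ℕ._+_ 0 (map f (allFin n))

maxFinℕ : ∀ {n} → (Fin n → ℕ) → ℕ
maxFinℕ {n} f = foldr _⊔_ 0 (map f (allFin n))

sumℚ : List ℚ → ℚ
sumℚ = foldr ℚ._+_ 0ℚ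

sumFinℚ : ∀ {N} → (Fin N → ℚ) → ℚ
sumFinℚ {N} f = sumℚ (map f (allFin N))

ℕtoℚ : ℕ → ℚ
ℕtoℚ m = + m / 1

subsetsOf : ∀ {N} → Subset N → List (Subset N)
subsetsOf []             = [] ∷ []
subsetsOf (outside ∷ R)  = map (outside ∷_) (subsetsOf R)
subsetsOf (inside ∷ R)   = map (outside ∷_) (subsetsOf R) ++ map (inside ∷_) (subsetsOf R)

signℚ : ℕ → ℚ
signℚ zero    = 1ℚ
signℚ (suc k) = ℚ.- signℚ k

-- Linear systems  Σ_i a_{k,i} x_i ≤ b_k  over variable set Fin N,
-- given as a list of constraints (a_k , b_k).

Constraint : ℕ → Set
Constraint N = (Fin N → ℚ) × ℚ

LinSys : ℕ → Set
LinSys N = List (Constraint N)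

-- Sherali–Adams lift SA(P, r): vectors y indexed by subsets S ⊆ V
-- (only entries with |S| ≤ r are ever used), with y_∅ = 1 and, for every
-- constraint and all S, R with |S| + |R| ≤ r - 1, the linearised constraint.
liftedLHS : ∀ {N} → Constraint N → (Subset N → ℚ) → Subset N → Subset N → ℚ
liftedLHS {N} (a , b) y S R =
  sumℚ (map (λ R' → signℚ ∣ R' ∣ ℚ.*
                    (sumFinℚ (λ i → a i ℚ.* y (S ∪ (R' ∪ ⁅ i ⁆)))
                     ℚ.- b ℚ.* y (S ∪ R')))
            (subsetsOf R))

InSA : ∀ {N} → LinSys N → ℕ → (Subset N → ℚ) → Set
InSA {N} P r y =
  (y ⊥ ≡ 1ℚ) ×
  (∀ (k : Fin (length P)) (S R : Subset N) →
     suc (∣ S ∣ ℕ.+ ∣ R ∣) ℕ.≤ r →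
     liftedLHS (lookup P k) y S R ℚ.≤ 0ℚ)

SANonempty : ∀ {N} → LinSys N → ℕ → Set
SANonempty {N} P r = ∃ λ (y : Subset N → ℚ) → InSA P r y

record Instance (n : ℕ) : Set where
  field
    p : Fin n → ℕ
    r : Fin n → ℕ
    d : Fin n → ℕ
open Instance public

ValidInstance : ∀ {n} → Instance n → Set
ValidInstance {n} I = ∀ (j : Fin n) → (0 ℕ.< p I j) × (r I j ℕ.+ p I j ℕ.≤ d I j)

totalSize : ∀ {n} → Instance n → ℕ
totalSize I = sumFinℕ (p I)

maxDeadline : ∀ {n} → Instance n → ℕ
maxDeadline I = maxFinℕ (d I)

-- A solution: lengths p'_j ∈ [0, p_j] and integer start times t_j;
-- if p'_j > 0, job j runs during (t_j, t_j + p'_j] ⊆ (r_j, d_j];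
-- the processing intervals of distinct (processed) jobs are disjoint.
record Solution {n : ℕ} (I : Instance n) : Set where
  field
    len   : Fin n → ℕ
    start : Fin n → ℕ
    len≤p : ∀ j → len j ℕ.≤ p I j
    window : ∀ j → 0 ℕ.< len j → (r I j ℕ.≤ start j) × (start j ℕ.+ len j ℕ.≤ d I j)
    disjoint : ∀ j k → j ≢ k → 0 ℕ.< len j → 0 ℕ.< len k →
               (start j ℕ.+ len j ℕ.≤ start k) ⊎ (start k ℕ.+ len k ℕ.≤ start j)
open Solution public

cost : ∀ {n} {I : Instance n} → Solution I → ℕ
cost {I = I} s = sumFinℕ (λ j → p I j ∸ len s j)

-- variables (j, t, p') with p' ∈ {1..p_j}, t ∈ [r_j, d_j - p'] (integers)
variables : ∀ {n} → Instance n → List (Fin n × ℕ × ℕ)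
variables {n} I =
  concatMap (λ j →
    concatMap (λ q′ →
      map (λ u → (j , r I j ℕ.+ u , suc q′))
          (upTo (suc (d I j ∸ suc q′ ∸ r I j))))
      (upTo (p I j)))
    (allFin n)

NVars : ∀ {n} → Instance n → ℕ
NVars I = length (variables I)

varOf : ∀ {n} (I : Instance n) → Fin (NVars I) → Fin n × ℕ × ℕ
varOf I = lookup (variables I)

vJob : ∀ {n} (I : Instance n) → Fin (NVars I) → Fin n
vJob I i = proj₁ (varOf I i)

vStart : ∀ {n} (I : Instance n) → Fin (NVars I) → ℕ
vStart I i = proj₁ (proj₂ (varOf I i))

vLen : ∀ {n} (I : Instance n) → Fin (NVars I) → ℕ
vLen I i = proj₂ (proj₂ (varOf I i))

finEqℚ : ∀ {n} → Fin n → Fin n → ℚ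
finEqℚ a b with a Fin.≟ b
... | yes _ = 1ℚ
... | no  _ = 0ℚ

coversℚ : ℕ → ℕ → ℕ → ℚ
coversℚ t q t′ with t ℕ.<? t′ | t′ ℕ.≤? t ℕ.+ q
... | yes _ | yes _ = 1ℚ
... | _ | _ = 0ℚ

-- The constraints of P_I(B), as  Σ_i a_i x_i ≤ b:
--  (budget)   Σ_j (p_j − Σ x_{j,t,p'} p') ≤ B   i.e.  Σ_i (−p'_i) x_i ≤ B − Σ_j p_j
--  (jobs)     Σ_{t,p'} x_{j,t,p'} ≤ 1          for every j ∈ J
--  (time)     Σ_{(j,t,p') : t' ∈ (t,t+p']} x ≤ 1  for every t' ∈ [T] = {1,…,T}
--  (nonneg)   −x_i ≤ 0                          for every variable i
LP : ∀ {n} (I : Instance n) → ℚ → LinSys (NVars I)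
LP {n} I B =
  ((λ i → ℚ.- ℕtoℚ (vLen I i)) , B ℚ.- ℕtoℚ (totalSize I))
  ∷ (map (λ j → (λ i → finEqℚ (vJob I i) j) , 1ℚ) (allFin n)
  ++ map (λ u → (λ i → coversℚ (vStart I i) (vLen I i) (suc u)) , 1ℚ)
         (upTo (totalSize I))
  ++ map (λ i₀ → (λ i → ℚ.- finEqℚ i i₀) , 0ℚ) (allFin (NVars I)))

-- ⌊ q · log₂ m ⌋ = k  for a positive rational q = a/b and m ≥ 1:
--   k ≤ q log₂ m < k + 1  ⇔  2^(k b) ≤ m^a < 2^((k+1) b)

IsFloorMulLog₂ : ℚ → ℕ → ℕ → Set
IsFloorMulLog₂ q m k =
  (2 ^ (k ℕ.* ↧ₙ q) ℕ.≤ m ^ ℤ.∣ ↥ q ∣) × (m ^ ℤ.∣ ↥ q ∣ ℕ.< 2 ^ (suc k ℕ.* ↧ₙ q))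

InfinitelyMany : (ℕ → Set) → Set
InfinitelyMany P = ∀ (m : ℕ) → ∃ λ n → (m ℕ.≤ n) × P n

{-# OPTIONS --safe #-}
-- Proof idea.  Let L = 2h, P = 10L and T = PL.  The instance has h long jobs of
-- size P that may run anywhere in (0,T], and for each of the P cells (WL,WL+L]
-- of the time axis h unit jobs that must run inside that cell.
--
-- Integrality.  A long job processed for time ℓ swallows at least ℓ/L − 2 whole
-- cells and thereby kills the h unit jobs of each of them, which is about half
-- of what it gains; hence every schedule loses at least T/4 − O(h²) ≥ T/5.
--
-- Lifted solution.  Call a variable canonical if it runs its job in full in one
-- of the L aligned slots of its window, and cut (0,T] into L blocks of length P.
-- Two canonical variables conflict if they share the job or the block.  Put
-- y_S = ρ^|S| if S consists of pairwise non-conflicting canonical variables and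
-- y_S = 0 otherwise, where ρ = 1/(L+k), so that Lρ = 1 − kρ.  For disjoint S, R
-- with |R| ≤ k the inclusion–exclusion sum over R lies between (1 − kρ) y_S and
-- y_S.  A job or time constraint is a clique of L canonical variables of total
-- weight Lρ = 1 − kρ, so it survives the lift.  Every element of S ∪ R rules out
-- canonical variables of total length at most 2T, out of LT, so the lifted budget
-- constraint holds with loss at most 4kρT ≤ εT.  As the number n of jobs is at
-- most 2^(7h), a level of order ε log n is far below εL/4.
module Submission where

open import Defs
open import Data.Empty using (⊥-elim)
open import Data.Fin as Fin using (Fin; zero; suc; toℕ; _↑ˡ_; _↑ʳ_; combine; splitAt; quotient)
import Data.Fin.Properties as Finₚ
open import Data.Fin.Subset using (Subset; ⊥; ⁅_⁆; _∪_; ∣_∣; inside; outside; _∈_; _∉_)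
open import Data.Fin.Subset.Properties using (∪-identityʳ; ∪-assoc; ∪-comm; _∈?_; x∈p∪q⁻; x∈p∪q⁺; x∈⁅y⁆⇒x≡y; x∈⁅x⁆; drop-there; ∉⊥; ∣⊥∣≡0)
open import Data.Integer as ℤ using (+_; +[1+_])
import Data.Integer.Tactic.RingSolver as ℤSolver
open import Data.List using (List; []; _∷_; _++_; map; concatMap; allFin; upTo; applyUpTo; tabulate; lookup; foldr)
open import Data.List.Membership.Propositional.Properties using (∈-lookup)
open import Data.List.Properties using (map-tabulate; map-∘; tabulate-lookup)
open import Data.List.Relation.Unary.All as All using (All; []; _∷_)
import Data.List.Relation.Unary.All.Properties as Allₚ
open import Data.List.Relation.Unary.AllPairs using ([]; _∷_)
open import Data.List.Relation.Unary.Unique.Propositional using (Unique)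
open import Data.List.Relation.Unary.Unique.Propositional.Properties using (allFin⁺)
open import Data.Maybe using (Maybe; just; nothing; maybe′)
open import Data.Nat as ℕ using (ℕ; zero; suc; z≤n; s≤s; _^_)
open import Data.Nat.DivMod using (m≡m%n+[m/n]*n; m%n<n; m/n*n≤m; m*n/n≡m; /-monoˡ-≤; m<n*o⇒m/o<n)
import Data.Nat.Divisibility as Div
import Data.Nat.Properties as ℕₚ
import Data.Nat.Tactic.RingSolver as ℕSolver
open import Data.Product using (_×_; _,_; proj₁; proj₂; ∃)
open import Data.Rational as ℚ using (ℚ; mkℚ; 0ℚ; 1ℚ; _/_; _+_; _-_; _*_; -_; _≤_; Positive)
open import Data.Rational.Properties
open import Data.Rational.Solver using (module +-*-Solver)
import Data.Rational.Unnormalised as ℚᵘ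
import Data.Rational.Unnormalised.Properties as ℚᵘₚ
open import Data.Sum as Sum using (_⊎_; inj₁; inj₂; [_,_]′)
open import Data.Vec using ([]; _∷_; here; there)
open import Function using (_∘_; id)
open import Relation.Nullary using (¬_; Dec; yes; no)
open import Relation.Nullary.Decidable using (¬?; _×-dec_; _→-dec_; _⊎-dec_)
open import Relation.Binary.PropositionalEquality hiding ([_])


-- Ordered-field arithmetic

*-monoˡ-≤-0≤ : ∀ {r p q} → 0ℚ ≤ r → p ≤ q → r * p ≤ r * q
*-monoˡ-≤-0≤ {r} 0≤r = *-monoˡ-≤-nonNeg r {{ℚ.nonNegative 0≤r}}

*-monoʳ-≤-0≤ : ∀ {r p q} → 0ℚ ≤ r → p ≤ q → p * r ≤ q * r
*-monoʳ-≤-0≤ {r} 0≤r = *-monoʳ-≤-nonNeg r {{ℚ.nonNegative 0≤r}}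

0≤* : ∀ {p q} → 0ℚ ≤ p → 0ℚ ≤ q → 0ℚ ≤ p * q
0≤* {p} {q} 0≤p 0≤q = subst (λ t → t ≤ p * q) (*-zeroʳ p) (*-monoˡ-≤-0≤ 0≤p 0≤q)

0≤+ : ∀ {p q} → 0ℚ ≤ p → 0ℚ ≤ q → 0ℚ ≤ p + q
0≤+ = +-mono-≤

p≤q⇒0≤q-p : ∀ {p q} → p ≤ q → 0ℚ ≤ q - p
p≤q⇒0≤q-p {p} {q} p≤q = subst (_≤ q - p) (+-inverseʳ p) (+-monoˡ-≤ (- p) p≤q)

0≤q-p⇒p≤q : ∀ {p q} → 0ℚ ≤ q - p → p ≤ q
0≤q-p⇒p≤q {p} {q} 0≤d = subst₂ _≤_ (+-identityˡ p)
  (solve 2 (λ p q → (q :- p) :+ p := q) refl p q) (+-monoˡ-≤ p 0≤d)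
  where open +-*-Solver

p-q≤p : ∀ {p q} → 0ℚ ≤ q → p - q ≤ p
p-q≤p {p} {q} 0≤q = subst (λ t → p - q ≤ t) (+-identityʳ p) (+-monoʳ-≤ p (neg-antimono-≤ 0≤q))


-- `ℕtoℚ` normalises by a gcd that is stuck on open terms, so the equation is checked on
-- unnormalised representatives, where it is a ring identity over the integers.
ℕtoℚ-homo-+ : ∀ m n → ℕtoℚ (m ℕ.+ n) ≡ ℕtoℚ m + ℕtoℚ n
ℕtoℚ-homo-+ m n = toℚᵘ-injective (begin
  ℚ.toℚᵘ (ℕtoℚ (m ℕ.+ n))                    ≈⟨ toℚᵘ-fromℚᵘ (ℚᵘ.mkℚᵘ (+ (m ℕ.+ n)) 0) ⟩
  ℚᵘ.mkℚᵘ (+ (m ℕ.+ n)) 0                    ≈⟨ ℚᵘ.*≡* (eq (+ m) (+ n)) ⟩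
  ℚᵘ.mkℚᵘ (+ m) 0 ℚᵘ.+ ℚᵘ.mkℚᵘ (+ n) 0       ≈⟨ ℚᵘₚ.+-cong (toℚᵘ-fromℚᵘ (ℚᵘ.mkℚᵘ (+ m) 0)) (toℚᵘ-fromℚᵘ (ℚᵘ.mkℚᵘ (+ n) 0)) ⟨
  ℚ.toℚᵘ (ℕtoℚ m) ℚᵘ.+ ℚ.toℚᵘ (ℕtoℚ n)       ≈⟨ toℚᵘ-homo-+ (ℕtoℚ m) (ℕtoℚ n) ⟨
  ℚ.toℚᵘ (ℕtoℚ m + ℕtoℚ n)                   ∎)
  where
  open import Relation.Binary.Reasoning.Setoid ℚᵘₚ.≃-setoid
  eq : ∀ a b → (a ℤ.+ b) ℤ.* + 1 ≡ (a ℤ.* + 1 ℤ.+ b ℤ.* + 1) ℤ.* + 1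
  eq = ℤSolver.solve-∀

/-*-denominator : ∀ a d → (+ a / suc d) * ℕtoℚ (suc d) ≡ ℕtoℚ a
/-*-denominator a d = toℚᵘ-injective (begin
  ℚ.toℚᵘ ((+ a / suc d) * ℕtoℚ (suc d))              ≈⟨ toℚᵘ-homo-* (+ a / suc d) (ℕtoℚ (suc d)) ⟩
  ℚ.toℚᵘ (+ a / suc d) ℚᵘ.* ℚ.toℚᵘ (ℕtoℚ (suc d))     ≈⟨ ℚᵘₚ.*-cong (toℚᵘ-fromℚᵘ (ℚᵘ.mkℚᵘ (+ a) d)) (toℚᵘ-fromℚᵘ (ℚᵘ.mkℚᵘ (+ suc d) 0)) ⟩
  ℚᵘ.mkℚᵘ (+ a) d ℚᵘ.* ℚᵘ.mkℚᵘ (+ suc d) 0           ≈⟨ ℚᵘ.*≡* (trans (eq (+ a) (+ suc d)) (cong (λ e → + a ℤ.* + suc e) (sym (ℕₚ.*-identityʳ d)))) ⟩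
  ℚᵘ.mkℚᵘ (+ a) 0                                    ≈⟨ toℚᵘ-fromℚᵘ (ℚᵘ.mkℚᵘ (+ a) 0) ⟨
  ℚ.toℚᵘ (ℕtoℚ a)                                    ∎)
  where
  open import Relation.Binary.Reasoning.Setoid ℚᵘₚ.≃-setoid
  eq : ∀ a b → (a ℤ.* b) ℤ.* + 1 ≡ a ℤ.* b
  eq = ℤSolver.solve-∀

ℕtoℚ-homo-* : ∀ m n → ℕtoℚ (m ℕ.* n) ≡ ℕtoℚ m * ℕtoℚ n
ℕtoℚ-homo-* zero    n = sym (*-zeroˡ (ℕtoℚ n))
ℕtoℚ-homo-* (suc m) n = begin
  ℕtoℚ (n ℕ.+ m ℕ.* n)          ≡⟨ ℕtoℚ-homo-+ n (m ℕ.* n) ⟩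
  ℕtoℚ n + ℕtoℚ (m ℕ.* n)       ≡⟨ cong (λ t → ℕtoℚ n + t) (ℕtoℚ-homo-* m n) ⟩
  ℕtoℚ n + ℕtoℚ m * ℕtoℚ n      ≡⟨ solve 2 (λ a b → b :+ a :* b := (con 1ℚ :+ a) :* b) refl (ℕtoℚ m) (ℕtoℚ n) ⟩
  (1ℚ + ℕtoℚ m) * ℕtoℚ n        ≡⟨ cong (_* ℕtoℚ n) (ℕtoℚ-homo-+ 1 m) ⟨
  ℕtoℚ (suc m) * ℕtoℚ n         ∎
  where
  open ≡-Reasoning
  open +-*-Solver

0≤ℕtoℚ : ∀ m → 0ℚ ≤ ℕtoℚ m
0≤ℕtoℚ m = nonNegative⁻¹ (ℕtoℚ m) {{normalize-nonNeg m 1}}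

ℕtoℚ-mono-≤ : ∀ {m n} → m ℕ.≤ n → ℕtoℚ m ≤ ℕtoℚ n
ℕtoℚ-mono-≤ {m} {n} m≤n = subst₂ _≤_ (+-identityʳ (ℕtoℚ m))
  (trans (sym (ℕtoℚ-homo-+ m (n ℕ.∸ m))) (cong ℕtoℚ (ℕₚ.m+[n∸m]≡n m≤n)))
  (+-monoʳ-≤ (ℕtoℚ m) (0≤ℕtoℚ (n ℕ.∸ m)))

-- Finite sums

∑ : ∀ {A : Set} → List A → (A → ℕ) → ℕ
∑ []       f = 0
∑ (x ∷ xs) f = f x ℕ.+ ∑ xs f

∑ℚ : ∀ {A : Set} → List A → (A → ℚ) → ℚ
∑ℚ xs f = sumℚ (map f xs)

module _ {A : Set} where

  ∑-cong : ∀ (xs : List A) {f g} → (∀ x → f x ≡ g x) → ∑ xs f ≡ ∑ xs g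
  ∑-cong []       eq = refl
  ∑-cong (x ∷ xs) eq = cong₂ ℕ._+_ (eq x) (∑-cong xs eq)

  ∑-mono : ∀ (xs : List A) {f g} → (∀ x → f x ℕ.≤ g x) → ∑ xs f ℕ.≤ ∑ xs g
  ∑-mono []       le = z≤n
  ∑-mono (x ∷ xs) le = ℕₚ.+-mono-≤ (le x) (∑-mono xs le)

  ∑-zero : ∀ (xs : List A) → ∑ xs (λ _ → 0) ≡ 0
  ∑-zero []       = refl
  ∑-zero (x ∷ xs) = ∑-zero xs

  ∑-+ : ∀ (xs : List A) f g → ∑ xs (λ x → f x ℕ.+ g x) ≡ ∑ xs f ℕ.+ ∑ xs g
  ∑-+ []       f g = refl
  ∑-+ (x ∷ xs) f g rewrite ∑-+ xs f g = interchange (f x) (g x) (∑ xs f) (∑ xs g)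
    where
    interchange : ∀ a b c d → a ℕ.+ b ℕ.+ (c ℕ.+ d) ≡ a ℕ.+ c ℕ.+ (b ℕ.+ d)
    interchange = ℕSolver.solve-∀

  ∑-*ˡ : ∀ c (xs : List A) f → ∑ xs (λ x → c ℕ.* f x) ≡ c ℕ.* ∑ xs f
  ∑-*ˡ c []       f = sym (ℕₚ.*-zeroʳ c)
  ∑-*ˡ c (x ∷ xs) f rewrite ∑-*ˡ c xs f = sym (ℕₚ.*-distribˡ-+ c (f x) (∑ xs f))

  ∑ℚ-cong : ∀ (xs : List A) {f g} → (∀ x → f x ≡ g x) → ∑ℚ xs f ≡ ∑ℚ xs g
  ∑ℚ-cong []       eq = refl
  ∑ℚ-cong (x ∷ xs) eq = cong₂ _+_ (eq x) (∑ℚ-cong xs eq)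

  ∑ℚ-mono : ∀ (xs : List A) {f g} → (∀ x → f x ≤ g x) → ∑ℚ xs f ≤ ∑ℚ xs g
  ∑ℚ-mono []       le = ≤-refl
  ∑ℚ-mono (x ∷ xs) le = +-mono-≤ (le x) (∑ℚ-mono xs le)

  ∑ℚ-zero : ∀ (xs : List A) → ∑ℚ xs (λ _ → 0ℚ) ≡ 0ℚ
  ∑ℚ-zero []       = refl
  ∑ℚ-zero (x ∷ xs) = trans (+-identityˡ _) (∑ℚ-zero xs)

  ∑ℚ-+ : ∀ (xs : List A) f g → ∑ℚ xs (λ x → f x + g x) ≡ ∑ℚ xs f + ∑ℚ xs g
  ∑ℚ-+ []       f g = refl
  ∑ℚ-+ (x ∷ xs) f g = trans (cong (λ t → f x + g x + t) (∑ℚ-+ xs f g))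
    (solve 4 (λ a b c d → (a :+ b) :+ (c :+ d) := (a :+ c) :+ (b :+ d)) refl (f x) (g x) (∑ℚ xs f) (∑ℚ xs g))
    where open +-*-Solver

  ∑ℚ-*ˡ : ∀ c (xs : List A) f → ∑ℚ xs (λ x → c * f x) ≡ c * ∑ℚ xs f
  ∑ℚ-*ˡ c []       f = sym (*-zeroʳ c)
  ∑ℚ-*ˡ c (x ∷ xs) f = trans (cong (λ t → c * f x + t) (∑ℚ-*ˡ c xs f)) (sym (*-distribˡ-+ c (f x) (∑ℚ xs f)))

  ∑ℚ-neg : ∀ (xs : List A) f → ∑ℚ xs (λ x → - f x) ≡ - ∑ℚ xs f
  ∑ℚ-neg []       f = refl
  ∑ℚ-neg (x ∷ xs) f = trans (cong (λ t → - f x + t) (∑ℚ-neg xs f)) (sym (neg-distrib-+ (f x) (∑ℚ xs f)))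

  ∑ℚ-ℕtoℚ : ∀ (xs : List A) f → ∑ℚ xs (λ x → ℕtoℚ (f x)) ≡ ℕtoℚ (∑ xs f)
  ∑ℚ-ℕtoℚ []       f = refl
  ∑ℚ-ℕtoℚ (x ∷ xs) f = trans (cong (λ t → ℕtoℚ (f x) + t) (∑ℚ-ℕtoℚ xs f)) (sym (ℕtoℚ-homo-+ (f x) (∑ xs f)))

∑-∈-≤ : ∀ {N} (f : Fin N → ℕ) i → f i ℕ.≤ ∑ (allFin N) f
∑-∈-≤ f i = go f id i
  where
  go : ∀ {M} {B : Set} (g : B → ℕ) (h : Fin M → B) j → g (h j) ℕ.≤ ∑ (tabulate h) g
  go g h zero    = ℕₚ.m≤m+n _ _
  go g h (suc j) = ℕₚ.≤-trans (go g (h ∘ suc) j) (ℕₚ.m≤n+m _ _)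

∑-swap : ∀ {A B : Set} (xs : List A) (ys : List B) (f : A → B → ℕ) →
         ∑ xs (λ x → ∑ ys (f x)) ≡ ∑ ys (λ y → ∑ xs (λ x → f x y))
∑-swap []       ys f = sym (∑-zero ys)
∑-swap (x ∷ xs) ys f = trans (cong (∑ ys (f x) ℕ.+_) (∑-swap xs ys f)) (sym (∑-+ ys (f x) _))

∑ℚ-swap : ∀ {A B : Set} (xs : List A) (ys : List B) (f : A → B → ℚ) →
          ∑ℚ xs (λ x → ∑ℚ ys (f x)) ≡ ∑ℚ ys (λ y → ∑ℚ xs (λ x → f x y))
∑ℚ-swap []       ys f = sym (∑ℚ-zero ys)
∑ℚ-swap (x ∷ xs) ys f = trans (cong (λ t → ∑ℚ ys (f x) + t) (∑ℚ-swap xs ys f)) (sym (∑ℚ-+ ys (f x) _))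

∑ℚ-map : ∀ {A B : Set} (g : A → B) (xs : List A) f → ∑ℚ (map g xs) f ≡ ∑ℚ xs (f ∘ g)
∑ℚ-map g xs f = cong sumℚ (sym (map-∘ xs))

∑ℚ-++ : ∀ {A : Set} (xs ys : List A) f → ∑ℚ (xs ++ ys) f ≡ ∑ℚ xs f + ∑ℚ ys f
∑ℚ-++ []       ys f = sym (+-identityˡ _)
∑ℚ-++ (x ∷ xs) ys f = trans (cong (λ t → f x + t) (∑ℚ-++ xs ys f)) (sym (+-assoc (f x) _ _))

-- `allFin (suc N)` unfolds to a tabulation of `suc`, not to an image of `allFin N`; inductions on
-- the size of an index set go through this reindexing.
∑-allFin-suc : ∀ {N} (f : Fin (suc N) → ℕ) → ∑ (allFin (suc N)) f ≡ f zero ℕ.+ ∑ (allFin N) (f ∘ suc)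
∑-allFin-suc {N} f = cong (f zero ℕ.+_) (go suc id)
  where
  go : ∀ {M} {B : Set} (g : B → Fin (suc N)) (h : Fin M → B) → ∑ (tabulate (g ∘ h)) f ≡ ∑ (tabulate h) (f ∘ g)
  go {zero}  g h = refl
  go {suc M} g h = cong (f (g (h zero)) ℕ.+_) (go g (h ∘ suc))

-- Indicators

ι : ∀ {P : Set} → Dec P → ℕ
ι (yes _) = 1
ι (no  _) = 0

ι-true : ∀ {P : Set} (P? : Dec P) → P → ι P? ≡ 1
ι-true (yes _) _ = refl
ι-true (no ¬p) p = ⊥-elim (¬p p)

ι-false : ∀ {P : Set} (P? : Dec P) → ¬ P → ι P? ≡ 0
ι-false (yes p) ¬p = ⊥-elim (¬p p)
ι-false (no _)  _  = refl

ι-cong : ∀ {P Q : Set} (P? : Dec P) (Q? : Dec Q) → (P → Q) → (Q → P) → ι P? ≡ ι Q?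
ι-cong P? (yes q) f g = ι-true P? (g q)
ι-cong P? (no ¬q) f g = ι-false P? (¬q ∘ f)

ι-≟-sum : ∀ {N} (i : Fin N) → ∑ (allFin N) (λ j → ι (j Fin.≟ i)) ≡ 1
ι-≟-sum {suc N} zero    = trans (∑-allFin-suc (λ (j : Fin (suc N)) → ι (j Fin.≟ zero))) (cong suc (trans (∑-cong (allFin N) λ j → ι-false (suc j Fin.≟ zero) λ ()) (∑-zero (allFin N))))
ι-≟-sum {suc N} (suc i) = trans (∑-allFin-suc (λ j → ι (j Fin.≟ suc i))) (trans (∑-cong (allFin N) step) (ι-≟-sum i))
  where
  step : ∀ j → ι (suc j Fin.≟ suc i) ≡ ι (j Fin.≟ i)
  step j = ι-cong (suc j Fin.≟ suc i) (j Fin.≟ i) Finₚ.suc-injective (cong suc)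

ι-∈-sum : ∀ {N} (S : Subset N) → ∑ (allFin N) (λ i → ι (i ∈? S)) ≡ ∣ S ∣
ι-∈-sum {zero}  []      = refl
ι-∈-sum {suc N} (s ∷ S) = trans (∑-allFin-suc (λ i → ι (i ∈? (s ∷ S)))) (trans (cong (ι (zero ∈? (s ∷ S)) ℕ.+_) (trans (∑-cong (allFin N) step) (ι-∈-sum S))) (head s))
  where
  step : ∀ i → ι (suc i ∈? (s ∷ S)) ≡ ι (i ∈? S)
  step i = ι-cong (suc i ∈? (s ∷ S)) (i ∈? S) drop-there there
  head : ∀ s → ι (zero ∈? (s ∷ S)) ℕ.+ ∣ S ∣ ≡ ∣ s ∷ S ∣
  head inside  = refl
  head outside = refl

-- Inclusion–exclusion sums

-- If `y` were the joint moments of a 0-1 distribution, this would be the probability that all of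
-- `S` and none of `R` is chosen.
altSum : ∀ {N} → (Subset N → ℚ) → Subset N → Subset N → ℚ
altSum y S R = ∑ℚ (subsetsOf R) (λ R' → signℚ ∣ R' ∣ * y (S ∪ R'))

altSum-outside : ∀ {N} (y : Subset (suc N) → ℚ) s S R →
  altSum y (s ∷ S) (outside ∷ R) ≡ altSum (y ∘ (s ∷_)) S R
altSum-outside y inside  S R = ∑ℚ-map (outside ∷_) (subsetsOf R) _
altSum-outside y outside S R = ∑ℚ-map (outside ∷_) (subsetsOf R) _

-- The subsets of `inside ∷ R` split by their first entry; those with `inside` carry one more sign
-- and turn the head of the union into `inside`, whatever `s` is.
altSum-inside : ∀ {N} (y : Subset (suc N) → ℚ) s S R →
  altSum y (s ∷ S) (inside ∷ R) ≡ altSum (y ∘ (s ∷_)) S R - altSum (y ∘ (inside ∷_)) S R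
altSum-inside y s S R = begin
  altSum y (s ∷ S) (inside ∷ R)
    ≡⟨ ∑ℚ-++ (map (outside ∷_) (subsetsOf R)) _ term ⟩
  altSum y (s ∷ S) (outside ∷ R) + ∑ℚ (map (inside ∷_) (subsetsOf R)) term
    ≡⟨ cong₂ _+_ (altSum-outside y s S R) (trans (∑ℚ-map (inside ∷_) (subsetsOf R) term) (trans (∑ℚ-cong (subsetsOf R) (flip s)) (∑ℚ-neg (subsetsOf R) _))) ⟩
  altSum (y ∘ (s ∷_)) S R - altSum (y ∘ (inside ∷_)) S R
    ∎
  where
  open ≡-Reasoning
  term : Subset _ → ℚ
  term R' = signℚ ∣ R' ∣ * y ((s ∷ S) ∪ R')
  flip : ∀ s R' → signℚ (suc ∣ R' ∣) * y ((s ∷ S) ∪ (inside ∷ R')) ≡ - (signℚ ∣ R' ∣ * y (inside ∷ (S ∪ R')))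
  flip inside  R' = sym (neg-distribˡ-* (signℚ ∣ R' ∣) (y (inside ∷ (S ∪ R'))))
  flip outside R' = sym (neg-distribˡ-* (signℚ ∣ R' ∣) (y (inside ∷ (S ∪ R'))))

Disjoint : ∀ {N} → Subset N → Subset N → Set
Disjoint S R = ∀ i → i ∈ S → i ∉ R

-- The subsets of `R` pair up by toggling `i`: the union with `S` stays the same and the sign flips.
altSum-meet : ∀ {N} (y : Subset N → ℚ) {S R i} → i ∈ S → i ∈ R → altSum y S R ≡ 0ℚ
altSum-meet y {_ ∷ S} {_ ∷ R} here here = trans (altSum-inside y inside S R) (+-inverseʳ (altSum (y ∘ (inside ∷_)) S R))
altSum-meet y {s ∷ S} {outside ∷ R} (there i∈S) (there i∈R) = trans (altSum-outside y s S R) (altSum-meet (y ∘ (s ∷_)) i∈S i∈R)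
altSum-meet y {s ∷ S} {inside ∷ R} (there i∈S) (there i∈R) = trans (altSum-inside y s S R)
  (cong₂ _-_ (altSum-meet (y ∘ (s ∷_)) i∈S i∈R) (altSum-meet (y ∘ (inside ∷_)) i∈S i∈R))

-- The property of the solution behind the Bonferroni bounds. It is inherited when the head of the
-- subset is fixed, which lets the induction run over the index set.
record Decaying {N} (ρ : ℚ) (y : Subset N → ℚ) : Set where
  field
    nonneg : ∀ S → 0ℚ ≤ y S
    step   : ∀ S i → i ∉ S → y (S ∪ ⁅ i ⁆) ≤ ρ * y S
open Decaying

decaying-∷ : ∀ {N ρ} {y : Subset (suc N) → ℚ} s → Decaying ρ y → Decaying ρ (y ∘ (s ∷_))
decaying-∷ {y = y} s D .nonneg S = nonneg D (s ∷ S)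
decaying-∷ {ρ = ρ} {y = y} s D .step S i i∉S = subst (λ T → y T ≤ ρ * y (s ∷ S)) (eq s) (step D (s ∷ S) (suc i) (i∉S ∘ drop-there))
  where
  eq : ∀ s → (s ∷ S) ∪ ⁅ suc i ⁆ ≡ s ∷ (S ∪ ⁅ i ⁆)
  eq inside  = refl
  eq outside = refl

-- Bonferroni: the first inclusion–exclusion term dominates because y decays.
altSum-bounds : ∀ {N ρ} {y : Subset N → ℚ} → 0ℚ ≤ ρ → Decaying ρ y → ∀ S R → Disjoint S R →
  0ℚ ≤ 1ℚ - ℕtoℚ ∣ R ∣ * ρ →
  (1ℚ - ℕtoℚ ∣ R ∣ * ρ) * y S ≤ altSum y S R × altSum y S R ≤ y S
altSum-bounds {ρ = ρ} {y} 0≤ρ D [] [] dis _ =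
  ≤-reflexive (solve 2 (λ ρ y → (con 1ℚ :- con 0ℚ :* ρ) :* y := con 1ℚ :* y :+ con 0ℚ) refl ρ (y [])) ,
  ≤-reflexive (solve 1 (λ y → con 1ℚ :* y :+ con 0ℚ := y) refl (y []))
  where open +-*-Solver
altSum-bounds {y = y} 0≤ρ D (s ∷ S) (outside ∷ R) dis 0≤ rewrite altSum-outside y s S R =
  altSum-bounds 0≤ρ (decaying-∷ s D) S R (λ i i∈S i∈R → dis (suc i) (there i∈S) (there i∈R)) 0≤
altSum-bounds 0≤ρ D (inside ∷ S) (inside ∷ R) dis 0≤ = ⊥-elim (dis zero here here)
altSum-bounds {ρ = ρ} {y} 0≤ρ D (outside ∷ S) (inside ∷ R) dis 0≤
  rewrite altSum-inside y outside S R | ℕtoℚ-homo-+ 1 ∣ R ∣ = lower , upper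
  where
  open ≤-Reasoning
  open +-*-Solver
  u = ℕtoℚ ∣ R ∣
  yₒ = y (outside ∷ S)
  yᵢ = y (inside ∷ S)
  Fₒ = altSum (y ∘ (outside ∷_)) S R
  Fᵢ = altSum (y ∘ (inside ∷_)) S R
  dis' : Disjoint S R
  dis' i i∈S i∈R = dis (suc i) (there i∈S) (there i∈R)
  0≤' : 0ℚ ≤ 1ℚ - u * ρ
  -- Dropping one index from `R` enlarges the factor by `ρ`, so the hypothesis passes to the tail.
  0≤' = begin
    0ℚ                     ≤⟨ 0≤ ⟩
    1ℚ - (1ℚ + u) * ρ      ≡⟨ solve 2 (λ u ρ → con 1ℚ :- (con 1ℚ :+ u) :* ρ := con 1ℚ :- u :* ρ :- ρ) refl u ρ ⟩
    1ℚ - u * ρ - ρ         ≤⟨ p-q≤p 0≤ρ ⟩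
    1ℚ - u * ρ             ∎
  IHₒ = altSum-bounds 0≤ρ (decaying-∷ outside D) S R dis' 0≤'
  IHᵢ = altSum-bounds 0≤ρ (decaying-∷ inside D) S R dis' 0≤'
  yᵢ≤ρyₒ : yᵢ ≤ ρ * yₒ
  yᵢ≤ρyₒ = subst (λ T → y (inside ∷ T) ≤ ρ * yₒ) (∪-identityʳ S) (step D (outside ∷ S) zero λ ())
  lower : (1ℚ - (1ℚ + u) * ρ) * yₒ ≤ Fₒ - Fᵢ
  lower = begin
    (1ℚ - (1ℚ + u) * ρ) * yₒ       ≡⟨ solve 3 (λ u ρ y → (con 1ℚ :- (con 1ℚ :+ u) :* ρ) :* y := (con 1ℚ :- u :* ρ) :* y :- ρ :* y) refl u ρ yₒ ⟩
    -- The subtracted sum is at most `yᵢ`, which decay bounds by `ρ * yₒ`: the one further `ρ` lost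
    -- for the new index.
    (1ℚ - u * ρ) * yₒ - ρ * yₒ     ≤⟨ +-mono-≤ (proj₁ IHₒ) (neg-antimono-≤ (≤-trans (proj₂ IHᵢ) yᵢ≤ρyₒ)) ⟩
    Fₒ - Fᵢ                        ∎
  upper : Fₒ - Fᵢ ≤ yₒ
  -- The subtracted sum is nonnegative by its own lower bound, because the factor of the tail is
  -- nonnegative.
  upper = ≤-trans (p-q≤p (≤-trans (0≤* 0≤' (nonneg D (inside ∷ S))) (proj₁ IHᵢ))) (proj₂ IHₒ)


-- Linearised constraints as inclusion-exclusion sums

∪-swap : ∀ {N} (S R T : Subset N) → S ∪ (R ∪ T) ≡ (S ∪ T) ∪ R
∪-swap S R T = trans (cong (S ∪_) (∪-comm R T)) (sym (∪-assoc S T R))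

-- Moving `⁅ i ⁆` from the side of `R'` to `S` and exchanging the sums gives back the original
-- constraint, with each variable replaced by `altSum` at `S ∪ ⁅ i ⁆` and the constant 1 by `altSum`
-- at `S`.
liftedLHS-altSum : ∀ {N} (a : Fin N → ℚ) b y S R →
  liftedLHS (a , b) y S R ≡ ∑ℚ (allFin N) (λ i → a i * altSum y (S ∪ ⁅ i ⁆) R) - b * altSum y S R
liftedLHS-altSum {N} a b y S R = begin
  ∑ℚ Rs (λ R' → sg R' * (∑ℚ is (λ i → a i * y (S ∪ (R' ∪ ⁅ i ⁆))) - b * y (S ∪ R')))
    ≡⟨ ∑ℚ-cong Rs expand ⟩
  ∑ℚ Rs (λ R' → ∑ℚ is (λ i → a i * (sg R' * y ((S ∪ ⁅ i ⁆) ∪ R'))) + (- b) * (sg R' * y (S ∪ R')))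
    ≡⟨ ∑ℚ-+ Rs _ _ ⟩
  ∑ℚ Rs (λ R' → ∑ℚ is (λ i → a i * (sg R' * y ((S ∪ ⁅ i ⁆) ∪ R')))) + ∑ℚ Rs (λ R' → (- b) * (sg R' * y (S ∪ R')))
    ≡⟨ cong₂ _+_ (trans (∑ℚ-swap Rs is _) (∑ℚ-cong is (λ i → ∑ℚ-*ˡ (a i) Rs _)))
                 (trans (∑ℚ-*ˡ (- b) Rs _) (sym (neg-distribˡ-* b (altSum y S R)))) ⟩
  ∑ℚ is (λ i → a i * altSum y (S ∪ ⁅ i ⁆) R) - b * altSum y S R
    ∎
  where
  open ≡-Reasoning
  open +-*-Solver
  Rs = subsetsOf R
  is = allFin N
  sg : Subset N → ℚ
  sg R' = signℚ ∣ R' ∣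
  expand : ∀ R' → sg R' * (∑ℚ is (λ i → a i * y (S ∪ (R' ∪ ⁅ i ⁆))) - b * y (S ∪ R'))
                ≡ ∑ℚ is (λ i → a i * (sg R' * y ((S ∪ ⁅ i ⁆) ∪ R'))) + (- b) * (sg R' * y (S ∪ R'))
  expand R' = begin
    sg R' * (∑ℚ is (λ i → a i * y (S ∪ (R' ∪ ⁅ i ⁆))) - b * y (S ∪ R'))
      ≡⟨ solve 4 (λ s t b v → s :* (t :- b :* v) := s :* t :+ (:- b) :* (s :* v)) refl (sg R') _ b (y (S ∪ R')) ⟩
    sg R' * ∑ℚ is (λ i → a i * y (S ∪ (R' ∪ ⁅ i ⁆))) + (- b) * (sg R' * y (S ∪ R'))
      ≡⟨ cong (_+ (- b) * (sg R' * y (S ∪ R'))) (trans (sym (∑ℚ-*ˡ (sg R') is _)) (∑ℚ-cong is λ i →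
           trans (cong (λ T → sg R' * (a i * y T)) (∪-swap S R' ⁅ i ⁆))
                 (solve 3 (λ s c v → s :* (c :* v) := c :* (s :* v)) refl (sg R') (a i) _))) ⟩
    ∑ℚ is (λ i → a i * (sg R' * y ((S ∪ ⁅ i ⁆) ∪ R'))) + (- b) * (sg R' * y (S ∪ R'))
      ∎

∈⇒∪-absorbs : ∀ {N} {S : Subset N} {i} → i ∈ S → S ∪ ⁅ i ⁆ ≡ S
∈⇒∪-absorbs {S = inside ∷ S}  here        = cong (inside ∷_) (∪-identityʳ S)
∈⇒∪-absorbs {S = inside ∷ S}  (there i∈S) = cong (inside ∷_) (∈⇒∪-absorbs i∈S)
∈⇒∪-absorbs {S = outside ∷ S} (there i∈S) = cong (outside ∷_) (∈⇒∪-absorbs i∈S)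

∉⇒∣∪∣ : ∀ {N} {S : Subset N} {i} → i ∉ S → ∣ S ∪ ⁅ i ⁆ ∣ ≡ suc ∣ S ∣
∉⇒∣∪∣ {S = inside ∷ S}  {zero}  i∉S = ⊥-elim (i∉S here)
∉⇒∣∪∣ {S = outside ∷ S} {zero}  i∉S = cong (suc ∘ ∣_∣) (∪-identityʳ S)
∉⇒∣∪∣ {S = inside ∷ S}  {suc i} i∉S = cong suc (∉⇒∣∪∣ (i∉S ∘ there))
∉⇒∣∪∣ {S = outside ∷ S} {suc i} i∉S = ∉⇒∣∪∣ (i∉S ∘ there)

-- Pseudo-distributions on independent sets

infixr 8 _^ℚ_
_^ℚ_ : ℚ → ℕ → ℚ
x ^ℚ zero  = 1ℚ
x ^ℚ suc m = x * x ^ℚ m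

0≤^ℚ : ∀ {x} m → 0ℚ ≤ x → 0ℚ ≤ x ^ℚ m
0≤^ℚ zero    0≤x = 0≤ℕtoℚ 1
0≤^ℚ (suc m) 0≤x = 0≤* 0≤x (0≤^ℚ m 0≤x)

*-swapʳ : ∀ a b c → (a * b) * c ≡ (a * c) * b
*-swapʳ = solve 3 (λ a b c → (a :* b) :* c := (a :* c) :* b) refl
  where open +-*-Solver

module IndependentSets {N : ℕ}
  (C : Fin N → Set) (C? : ∀ i → Dec (C i))
  (_#_ : Fin N → Fin N → Set) (_#?_ : ∀ i j → Dec (i # j)) (#-sym : ∀ {i j} → i # j → j # i)
  (ρ : ℚ) (0≤ρ : 0ℚ ≤ ρ)
  where

  -- The proviso `i ≢ j` admits a reflexive conflict relation, such as sharing a job.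
  Independent : Subset N → Set
  Independent S = (∀ i → i ∈ S → C i) × (∀ i j → i ∈ S → j ∈ S → i ≢ j → ¬ i # j)

  independent? : ∀ S → Dec (Independent S)
  independent? S =
    Finₚ.all? (λ i → i ∈? S →-dec C? i) ×-dec
    Finₚ.all? (λ i → Finₚ.all? (λ j → i ∈? S →-dec (j ∈? S →-dec (¬? (i Fin.≟ j) →-dec ¬? (i #? j)))))

  y : Subset N → ℚ
  y S = ℕtoℚ (ι (independent? S)) * ρ ^ℚ ∣ S ∣

  y-independent : ∀ {S} → Independent S → y S ≡ ρ ^ℚ ∣ S ∣
  y-independent {S} ind = trans (cong (λ c → ℕtoℚ c * ρ ^ℚ ∣ S ∣) (ι-true (independent? S) ind)) (*-identityˡ _)

  y-dependent : ∀ {S} → ¬ Independent S → y S ≡ 0ℚ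
  y-dependent {S} dep = trans (cong (λ c → ℕtoℚ c * ρ ^ℚ ∣ S ∣) (ι-false (independent? S) dep)) (*-zeroˡ (ρ ^ℚ ∣ S ∣))

  y-⊥ : y ⊥ ≡ 1ℚ
  y-⊥ = trans (y-independent ((λ i i∈⊥ → ⊥-elim (∉⊥ i∈⊥)) , (λ i j i∈⊥ → ⊥-elim (∉⊥ i∈⊥)))) (cong (ρ ^ℚ_) (∣⊥∣≡0 N))

  0≤y : ∀ S → 0ℚ ≤ y S
  0≤y S = 0≤* (0≤ℕtoℚ (ι (independent? S))) (0≤^ℚ ∣ S ∣ 0≤ρ)

  -- The value of `y` on the singleton of `i`, and the factor gained by adding `i` to a set without
  -- conflicts.
  weight : Fin N → ℚ
  weight i = ρ * ℕtoℚ (ι (C? i))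

  0≤weight : ∀ i → 0ℚ ≤ weight i
  0≤weight i = 0≤* 0≤ρ (0≤ℕtoℚ (ι (C? i)))

  weight≤ρ : ∀ i → weight i ≤ ρ
  weight≤ρ i with C? i
  ... | yes _ = ≤-reflexive (*-identityʳ ρ)
  ... | no  _ = subst (λ t → t ≤ ρ) (sym (*-zeroʳ ρ)) 0≤ρ

  private
    old : ∀ {S : Subset N} {i j} → j ∈ S → j ∈ S ∪ ⁅ i ⁆
    old j∈S = x∈p∪q⁺ (inj₁ j∈S)

    new : ∀ {S : Subset N} {i} → i ∈ S ∪ ⁅ i ⁆
    new = x∈p∪q⁺ (inj₂ (x∈⁅x⁆ _))

  independent-shrink : ∀ {S i} → Independent (S ∪ ⁅ i ⁆) → Independent S × C i
  independent-shrink (can , ind) =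
    ((λ j → can j ∘ old) , (λ j k j∈S k∈S → ind j k (old j∈S) (old k∈S))) , can _ new

  independent-extend : ∀ {S i} → Independent S → C i → (∀ s → s ∈ S → ¬ i # s) → Independent (S ∪ ⁅ i ⁆)
  independent-extend {S} {i} (can , ind) Ci i#̸S = can' , ind'
    where
    can' : ∀ j → j ∈ S ∪ ⁅ i ⁆ → C j
    can' j j∈ with x∈p∪q⁻ S ⁅ i ⁆ j∈
    ... | inj₁ j∈S = can j j∈S
    ... | inj₂ j∈i = subst C (sym (x∈⁅y⁆⇒x≡y i j∈i)) Ci
    ind' : ∀ j k → j ∈ S ∪ ⁅ i ⁆ → k ∈ S ∪ ⁅ i ⁆ → j ≢ k → ¬ j # k
    ind' j k j∈ k∈ j≢k j#k with x∈p∪q⁻ S ⁅ i ⁆ j∈ | x∈p∪q⁻ S ⁅ i ⁆ k∈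
    ... | inj₁ j∈S | inj₁ k∈S = ind j k j∈S k∈S j≢k j#k
    ... | inj₁ j∈S | inj₂ k∈i with refl ← x∈⁅y⁆⇒x≡y i k∈i = i#̸S j j∈S (#-sym j#k)
    ... | inj₂ j∈i | inj₁ k∈S with refl ← x∈⁅y⁆⇒x≡y i j∈i = i#̸S k k∈S j#k
    ... | inj₂ j∈i | inj₂ k∈i = j≢k (trans (x∈⁅y⁆⇒x≡y i j∈i) (sym (x∈⁅y⁆⇒x≡y i k∈i)))

  y-extend-independent : ∀ {S i} → i ∉ S → Independent (S ∪ ⁅ i ⁆) → y (S ∪ ⁅ i ⁆) ≡ weight i * y S
  y-extend-independent {S} {i} i∉S ind' = begin
    y (S ∪ ⁅ i ⁆)            ≡⟨ y-independent ind' ⟩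
    ρ ^ℚ ∣ S ∪ ⁅ i ⁆ ∣        ≡⟨ cong (ρ ^ℚ_) (∉⇒∣∪∣ i∉S) ⟩
    ρ * ρ ^ℚ ∣ S ∣            ≡⟨ cong (_* ρ ^ℚ ∣ S ∣) (sym (*-identityʳ ρ)) ⟩
    (ρ * 1ℚ) * ρ ^ℚ ∣ S ∣     ≡⟨ cong₂ (λ c t → (ρ * ℕtoℚ c) * t) (sym (ι-true (C? i) (proj₂ (independent-shrink ind')))) (sym (y-independent (proj₁ (independent-shrink ind')))) ⟩
    weight i * y S            ∎
    where open ≡-Reasoning

  y-extend-≤ : ∀ {S i} → i ∉ S → y (S ∪ ⁅ i ⁆) ≤ weight i * y S
  y-extend-≤ {S} {i} i∉S = go (independent? (S ∪ ⁅ i ⁆))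
    where
    go : Dec (Independent (S ∪ ⁅ i ⁆)) → y (S ∪ ⁅ i ⁆) ≤ weight i * y S
    go (yes ind') = ≤-reflexive (y-extend-independent i∉S ind')
    go (no dep)   = subst (_≤ weight i * y S) (sym (y-dependent dep)) (0≤* (0≤weight i) (0≤y S))

  -- If `i` is a candidate and `S` is independent, the union is independent again and equality
  -- holds; otherwise `weight i` or `y S` vanishes.
  y-extend-≥ : ∀ {S i} → i ∉ S → (∀ s → s ∈ S → ¬ i # s) → weight i * y S ≤ y (S ∪ ⁅ i ⁆)
  y-extend-≥ {S} {i} i∉S i#̸S = go (C? i) (independent? S)
    where
    0≤ = 0≤y (S ∪ ⁅ i ⁆)
    go : Dec (C i) → Dec (Independent S) → weight i * y S ≤ y (S ∪ ⁅ i ⁆)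
    go (yes Ci) (yes ind) = ≤-reflexive (sym (y-extend-independent i∉S (independent-extend ind Ci i#̸S)))
    go (no ¬Ci) _         = subst (λ t → t ≤ y (S ∪ ⁅ i ⁆)) (sym (trans (cong (λ c → ρ * ℕtoℚ c * y S) (ι-false (C? i) ¬Ci)) (trans (cong (_* y S) (*-zeroʳ ρ)) (*-zeroˡ (y S))))) 0≤
    go _        (no dep)  = subst (λ t → t ≤ y (S ∪ ⁅ i ⁆)) (sym (trans (cong (weight i *_) (y-dependent dep)) (*-zeroʳ (weight i)))) 0≤

  decaying : Decaying ρ y
  decaying = record
    { nonneg = 0≤y
    ; step   = λ S i i∉S → ≤-trans (y-extend-≤ i∉S) (*-monoʳ-≤-0≤ (0≤y S) (weight≤ρ i))
    }

  module Rounds (k : ℕ) (0≤θ : 0ℚ ≤ 1ℚ - ℕtoℚ k * ρ) where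

    -- The Bonferroni factor for `k` excluded indices, hence a lower bound for the factor of every
    -- smaller `R`.
    θ : ℚ
    θ = 1ℚ - ℕtoℚ k * ρ

    meet? : ∀ (S R : Subset N) → Dec (∃ λ i → i ∈ S × i ∈ R)
    meet? S R = Finₚ.any? (λ i → i ∈? S ×-dec i ∈? R)

    θ≤ : ∀ {m} → m ℕ.≤ k → θ ≤ 1ℚ - ℕtoℚ m * ρ
    θ≤ m≤k = +-monoʳ-≤ 1ℚ (neg-antimono-≤ (*-monoʳ-≤-0≤ 0≤ρ (ℕtoℚ-mono-≤ m≤k)))

    altSum-y-≥ : ∀ S R → ∣ R ∣ ℕ.≤ k → Disjoint S R → θ * y S ≤ altSum y S R
    altSum-y-≥ S R R≤k dis = ≤-trans (*-monoʳ-≤-0≤ (0≤y S) (θ≤ R≤k))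
      (proj₁ (altSum-bounds 0≤ρ decaying S R dis (≤-trans 0≤θ (θ≤ R≤k))))

    -- Where `S` and `R` meet, the sum vanishes and `y S` is nonnegative; elsewhere this is
    -- Bonferroni.
    altSum-y-≤ : ∀ S R → ∣ R ∣ ℕ.≤ k → altSum y S R ≤ y S
    altSum-y-≤ S R R≤k = go (meet? S R)
      where
      go : Dec (∃ λ i → i ∈ S × i ∈ R) → altSum y S R ≤ y S
      go (yes (i , i∈S , i∈R)) = subst (_≤ y S) (sym (altSum-meet y i∈S i∈R)) (0≤y S)
      go (no ¬meet) = proj₂ (altSum-bounds 0≤ρ decaying S R (λ i i∈S i∈R → ¬meet (i , i∈S , i∈R)) (≤-trans 0≤θ (θ≤ R≤k)))

    0≤altSum-y : ∀ S R → ∣ R ∣ ℕ.≤ k → 0ℚ ≤ altSum y S R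
    0≤altSum-y S R R≤k = go (meet? S R)
      where
      go : Dec (∃ λ i → i ∈ S × i ∈ R) → 0ℚ ≤ altSum y S R
      go (yes (i , i∈S , i∈R)) = ≤-reflexive (sym (altSum-meet y i∈S i∈R))
      go (no ¬meet) = ≤-trans (0≤* 0≤θ (0≤y S)) (altSum-y-≥ S R R≤k (λ i i∈S i∈R → ¬meet (i , i∈S , i∈R)))

    lifted-nonneg : ∀ (a : Fin N → ℚ) → (∀ i → 0ℚ ≤ a i) → ∀ {S R} → ∣ R ∣ ℕ.≤ k →
                    liftedLHS ((λ i → - a i) , 0ℚ) y S R ≤ 0ℚ
    lifted-nonneg a 0≤a {S} {R} R≤k = begin
      liftedLHS ((λ i → - a i) , 0ℚ) y S R                          ≡⟨ liftedLHS-altSum (λ i → - a i) 0ℚ y S R ⟩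
      ∑ℚ (allFin N) (λ i → - a i * F i) - 0ℚ * altSum y S R         ≤⟨ +-mono-≤ (∑ℚ-mono (allFin N) term) (≤-reflexive (cong -_ (*-zeroˡ (altSum y S R)))) ⟩
      ∑ℚ (allFin N) (λ _ → 0ℚ) - 0ℚ                                 ≡⟨ cong (_- 0ℚ) (∑ℚ-zero (allFin N)) ⟩
      0ℚ                                                            ∎
      where
      open ≤-Reasoning
      F : Fin N → ℚ
      F i = altSum y (S ∪ ⁅ i ⁆) R
      term : ∀ i → - a i * F i ≤ 0ℚ
      term i = subst (_≤ 0ℚ) (neg-distribˡ-* (a i) (F i)) (neg-antimono-≤ (0≤* (0≤a i) (0≤altSum-y (S ∪ ⁅ i ⁆) R R≤k)))

    -- Three cases. If `S` meets `R`, every sum vanishes. If `S` contains some `s` of `K`, only `s`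
    -- itself contributes, since any other member of the clique makes the union dependent. Otherwise
    -- at most `D` candidates contribute at most `ρ * y S` each, and `ρ * ℕtoℚ D ≤ θ` leaves room
    -- for the Bonferroni loss.
    lifted-clique : ∀ {K : Fin N → Set} (K? : ∀ i → Dec (K i)) (a : Fin N → ℚ) (D : ℕ) →
      (∀ i → a i ≡ ℕtoℚ (ι (K? i))) →
      (∀ i j → K i → K j → C i → C j → i # j) →
      ∑ (allFin N) (λ i → ι (K? i) ℕ.* ι (C? i)) ℕ.≤ D →
      ρ * ℕtoℚ D ≤ θ →
      ∀ {S R} → ∣ R ∣ ℕ.≤ k → liftedLHS (a , 1ℚ) y S R ≤ 0ℚ
    lifted-clique {K} K? a D a≡ clique ∑≤D D≤θ {S} {R} R≤k = begin
      liftedLHS (a , 1ℚ) y S R                                ≡⟨ liftedLHS-altSum a 1ℚ y S R ⟩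
      ∑ℚ (allFin N) (λ i → a i * F i) - 1ℚ * altSum y S R     ≡⟨ cong₂ _-_ (∑ℚ-cong (allFin N) (λ i → cong (_* F i) (a≡ i))) (*-identityˡ (altSum y S R)) ⟩
      ∑ℚ (allFin N) (λ i → κ i * F i) - altSum y S R          ≤⟨ +-monoˡ-≤ (- altSum y S R) (bound (meet? S R) (Finₚ.any? (λ s → s ∈? S ×-dec K? s))) ⟩
      altSum y S R - altSum y S R                             ≡⟨ +-inverseʳ (altSum y S R) ⟩
      0ℚ                                                      ∎
      where
      open ≤-Reasoning
      F κ : Fin N → ℚ
      F i = altSum y (S ∪ ⁅ i ⁆) R
      κ i = ℕtoℚ (ι (K? i))

      meeting : ∀ {j} → j ∈ S → j ∈ R → ∑ℚ (allFin N) (λ i → κ i * F i) ≤ altSum y S R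
      meeting j∈S j∈R = ≤-reflexive (trans
        (∑ℚ-cong (allFin N) (λ i → trans (cong (κ i *_) (altSum-meet y (old j∈S) j∈R)) (*-zeroʳ (κ i))))
        (trans (∑ℚ-zero (allFin N)) (sym (altSum-meet y j∈S j∈R))))

      occupied : ∀ {s} → s ∈ S → K s → ∑ℚ (allFin N) (λ i → κ i * F i) ≤ altSum y S R
      occupied {s} s∈S Ks = begin
        ∑ℚ (allFin N) (λ i → κ i * F i)                                 ≤⟨ ∑ℚ-mono (allFin N) (λ i → term i (i Fin.≟ s) (K? i)) ⟩
        ∑ℚ (allFin N) (λ i → altSum y S R * ℕtoℚ (ι (i Fin.≟ s)))       ≡⟨ ∑ℚ-*ˡ (altSum y S R) (allFin N) _ ⟩
        altSum y S R * ∑ℚ (allFin N) (λ i → ℕtoℚ (ι (i Fin.≟ s)))       ≡⟨ cong (altSum y S R *_) (trans (∑ℚ-ℕtoℚ (allFin N) _) (cong ℕtoℚ (ι-≟-sum s))) ⟩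
        altSum y S R * 1ℚ                                               ≡⟨ *-identityʳ (altSum y S R) ⟩
        altSum y S R                                                    ∎
        where
        term : ∀ i (i≟s : Dec (i ≡ s)) (k? : Dec (K i)) → ℕtoℚ (ι k?) * F i ≤ altSum y S R * ℕtoℚ (ι i≟s)
        -- Adding `s` changes nothing, so this one term is the whole right-hand side.
        term i (yes refl) (yes _) = ≤-reflexive (trans (*-identityˡ (F i)) (trans (cong (λ T → altSum y T R) (∈⇒∪-absorbs s∈S)) (sym (*-identityʳ (altSum y S R)))))
        term i (yes refl) (no ¬K) = ⊥-elim (¬K Ks)
        term i (no _)     (no _)  = ≤-reflexive (trans (*-zeroˡ (F i)) (sym (*-zeroʳ (altSum y S R))))
        term i (no i≢s)   (yes Ki) = begin
          1ℚ * F i               ≡⟨ *-identityˡ (F i) ⟩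
          F i                    ≤⟨ altSum-y-≤ (S ∪ ⁅ i ⁆) R R≤k ⟩
          y (S ∪ ⁅ i ⁆)          ≡⟨ y-dependent (λ ind → proj₂ ind i s new (old s∈S) i≢s (clique i s Ki Ks (proj₁ ind i new) (proj₁ ind s (old s∈S)))) ⟩
          0ℚ                     ≡⟨ sym (*-zeroʳ (altSum y S R)) ⟩
          altSum y S R * 0ℚ      ∎

      vacant : Disjoint S R → (∀ s → s ∈ S → ¬ K s) → ∑ℚ (allFin N) (λ i → κ i * F i) ≤ altSum y S R
      vacant dis S∌K = begin
        ∑ℚ (allFin N) (λ i → κ i * F i)                                           ≤⟨ ∑ℚ-mono (allFin N) (λ i → term i (K? i)) ⟩
        ∑ℚ (allFin N) (λ i → (ρ * y S) * ℕtoℚ (ι (K? i) ℕ.* ι (C? i)))            ≡⟨ trans (∑ℚ-*ˡ (ρ * y S) (allFin N) _) (cong (ρ * y S *_) (∑ℚ-ℕtoℚ (allFin N) _)) ⟩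
        (ρ * y S) * ℕtoℚ (∑ (allFin N) (λ i → ι (K? i) ℕ.* ι (C? i)))             ≤⟨ *-monoˡ-≤-0≤ (0≤* 0≤ρ (0≤y S)) (ℕtoℚ-mono-≤ ∑≤D) ⟩
        (ρ * y S) * ℕtoℚ D                                                        ≡⟨ *-swapʳ ρ (y S) (ℕtoℚ D) ⟩
        (ρ * ℕtoℚ D) * y S                                                        ≤⟨ *-monoʳ-≤-0≤ (0≤y S) D≤θ ⟩
        θ * y S                                                                   ≤⟨ altSum-y-≥ S R R≤k dis ⟩
        altSum y S R                                                              ∎
        where
        term : ∀ i (k? : Dec (K i)) → ℕtoℚ (ι k?) * F i ≤ (ρ * y S) * ℕtoℚ (ι k? ℕ.* ι (C? i))
        term i (no _)   = ≤-reflexive (trans (*-zeroˡ (F i)) (sym (*-zeroʳ (ρ * y S))))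
        term i (yes Ki) = begin
          1ℚ * F i                                  ≡⟨ *-identityˡ (F i) ⟩
          F i                                       ≤⟨ altSum-y-≤ (S ∪ ⁅ i ⁆) R R≤k ⟩
          y (S ∪ ⁅ i ⁆)                             ≤⟨ y-extend-≤ (λ i∈S → S∌K i i∈S Ki) ⟩
          ρ * ℕtoℚ (ι (C? i)) * y S                 ≡⟨ *-swapʳ ρ (ℕtoℚ (ι (C? i))) (y S) ⟩
          (ρ * y S) * ℕtoℚ (ι (C? i))               ≡⟨ cong (λ c → (ρ * y S) * ℕtoℚ c) (sym (ℕₚ.*-identityˡ (ι (C? i)))) ⟩
          (ρ * y S) * ℕtoℚ (1 ℕ.* ι (C? i))         ∎

      bound : Dec (∃ λ i → i ∈ S × i ∈ R) → Dec (∃ λ s → s ∈ S × K s) → ∑ℚ (allFin N) (λ i → κ i * F i) ≤ altSum y S R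
      bound (yes (_ , j∈S , j∈R)) _                  = meeting j∈S j∈R
      bound (no _)     (yes (_ , s∈S , Ks))          = occupied s∈S Ks
      bound (no ¬meet) (no ¬occ)                     = vacant (λ i i∈S i∈R → ¬meet (i , i∈S , i∈R)) (λ s s∈S Ks → ¬occ (s , s∈S , Ks))

    -- e s i ≥ 1 charges the loss of variable i to the element s ∈ S ∪ R ruling it out.
    lifted-budget : ∀ (len : Fin N → ℕ) (e : Fin N → Fin N → ℕ) (A D : ℕ) (b : ℚ) →
      (∀ i → 1 ℕ.≤ e i i) → (∀ s i → i # s → 1 ℕ.≤ e s i) →
      A ℕ.≤ ∑ (allFin N) (λ i → len i ℕ.* ι (C? i)) →
      (∀ s → ∑ (allFin N) (λ i → e s i ℕ.* (len i ℕ.* ι (C? i))) ℕ.≤ D) →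
      0ℚ ≤ - b → - b ≤ θ * (ρ * (ℕtoℚ A - ℕtoℚ (k ℕ.* D))) →
      ∀ {S R} → ∣ S ∣ ℕ.+ ∣ R ∣ ℕ.≤ k → liftedLHS ((λ i → - ℕtoℚ (len i)) , b) y S R ≤ 0ℚ
    lifted-budget len e A D b e-refl e-conf A≤ e≤D 0≤-b -b≤ {S} {R} SR≤k = begin
      liftedLHS ((λ i → - ℕtoℚ (len i)) , b) y S R                            ≡⟨ liftedLHS-altSum (λ i → - ℕtoℚ (len i)) b y S R ⟩
      ∑ℚ (allFin N) (λ i → - ℕtoℚ (len i) * F i) - b * altSum y S R           ≡⟨ cong₂ _+_ (trans (∑ℚ-cong (allFin N) (λ i → sym (neg-distribˡ-* (ℕtoℚ (len i)) (F i)))) (∑ℚ-neg (allFin N) _)) (neg-distribˡ-* b (altSum y S R)) ⟩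
      - ∑ℚ (allFin N) (λ i → ℕtoℚ (len i) * F i) + - b * altSum y S R         ≤⟨ +-monoʳ-≤ (- ∑ℚ (allFin N) (λ i → ℕtoℚ (len i) * F i)) bound ⟩
      - ∑ℚ (allFin N) (λ i → ℕtoℚ (len i) * F i) + ∑ℚ (allFin N) (λ i → ℕtoℚ (len i) * F i) ≡⟨ +-inverseˡ (∑ℚ (allFin N) (λ i → ℕtoℚ (len i) * F i)) ⟩
      0ℚ                                                                      ∎
      where
      open ≤-Reasoning
      open +-*-Solver

      neg-flip : ∀ c a b → - (c * (b - a)) ≡ c * (a - b)
      neg-flip = solve 3 (λ c a b → :- (c :* (b :- a)) := c :* (a :- b)) refl

      regroup₄ : ∀ t r d y → (t * (r * d)) * y ≡ (t * (r * y)) * d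
      regroup₄ = solve 4 (λ t r d y → (t :* (r :* d)) :* y := (t :* (r :* y)) :* d) refl

      regroup₅ : ∀ t r y l c → (t * (r * y)) * (l * c) ≡ l * (t * ((r * c) * y))
      regroup₅ = solve 5 (λ t r y l c → (t :* (r :* y)) :* (l :* c) := l :* (t :* ((r :* c) :* y))) refl

      R≤k : ∣ R ∣ ℕ.≤ k
      R≤k = ℕₚ.≤-trans (ℕₚ.m≤n+m _ ∣ S ∣) SR≤k
      F : Fin N → ℚ
      F i = altSum y (S ∪ ⁅ i ⁆) R
      -- `pen i` adds up the charges that the elements of `S` and `R` lay on `i`. Subtracting
      -- `g i * pen i` replaces a case distinction by a linear bound, in which a charged variable
      -- counts at most 0.
      g m pen : Fin N → ℕ
      g i = len i ℕ.* ι (C? i)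
      m s = ι (s ∈? S) ℕ.+ ι (s ∈? R)
      pen i = ∑ (allFin N) (λ s → m s ℕ.* e s i)
      c : ℚ
      c = θ * (ρ * y S)

      0≤c : 0ℚ ≤ c
      0≤c = 0≤* 0≤θ (0≤* 0≤ρ (0≤y S))

      penalised : ∀ i s → 1 ℕ.≤ m s → 1 ℕ.≤ e s i → 1 ℕ.≤ pen i
      penalised i s 1≤m 1≤e = ℕₚ.≤-trans (ℕₚ.*-mono-≤ 1≤m 1≤e) (∑-∈-≤ (λ s → m s ℕ.* e s i) s)

      m-S : ∀ {s} → s ∈ S → 1 ℕ.≤ m s
      m-S {s} s∈S = ℕₚ.≤-trans (ℕₚ.≤-reflexive (sym (ι-true (s ∈? S) s∈S))) (ℕₚ.m≤m+n _ _)

      m-R : ∀ {s} → s ∈ R → 1 ℕ.≤ m s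
      m-R {s} s∈R = ℕₚ.≤-trans (ℕₚ.≤-reflexive (sym (ι-true (s ∈? R) s∈R))) (ℕₚ.m≤n+m _ _)

      -- Double counting: after exchanging the sums there are at most `k` elements of `S` and `R`,
      -- each charging at most `D`.
      pen-total : ∑ (allFin N) (λ i → g i ℕ.* pen i) ℕ.≤ k ℕ.* D
      pen-total = ℕₚ.≤-trans (ℕₚ.≤-reflexive eq₁) (ℕₚ.≤-trans (∑-mono (allFin N) λ s → ℕₚ.*-monoʳ-≤ (m s) (e≤D s))
                    (ℕₚ.≤-trans (ℕₚ.≤-reflexive eq₂) (ℕₚ.*-monoˡ-≤ D SR≤k)))
        where
        eq₁ : ∑ (allFin N) (λ i → g i ℕ.* pen i) ≡ ∑ (allFin N) (λ s → m s ℕ.* ∑ (allFin N) (λ i → e s i ℕ.* g i))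
        eq₁ = trans (∑-cong (allFin N) (λ i → sym (∑-*ˡ (g i) (allFin N) _)))
                (trans (∑-swap (allFin N) (allFin N) _) (∑-cong (allFin N) λ s →
                  trans (∑-cong (allFin N) λ i → rearrange (g i) (m s) (e s i)) (∑-*ˡ (m s) (allFin N) _)))
          where
          rearrange : ∀ a b c → a ℕ.* (b ℕ.* c) ≡ b ℕ.* (c ℕ.* a)
          rearrange = ℕSolver.solve-∀
        eq₂ : ∑ (allFin N) (λ s → m s ℕ.* D) ≡ (∣ S ∣ ℕ.+ ∣ R ∣) ℕ.* D
        eq₂ = trans (∑-cong (allFin N) λ s → ℕₚ.*-comm (m s) D) (trans (∑-*ˡ D (allFin N) m)
                (trans (ℕₚ.*-comm D _) (cong (ℕ._* D) (trans (∑-+ (allFin N) _ _) (cong₂ ℕ._+_ (ι-∈-sum S) (ι-∈-sum R))))))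

      lenF≥0 : ∀ i → 0ℚ ≤ ℕtoℚ (len i) * F i
      lenF≥0 i = 0≤* (0≤ℕtoℚ (len i)) (0≤altSum-y (S ∪ ⁅ i ⁆) R R≤k)

      term : Disjoint S R → ∀ i → c * (ℕtoℚ (g i) - ℕtoℚ (g i ℕ.* pen i)) ≤ ℕtoℚ (len i) * F i
      term dis i = go (1 ℕ.≤? pen i)
       where
       go : Dec (1 ℕ.≤ pen i) → c * (ℕtoℚ (g i) - ℕtoℚ (g i ℕ.* pen i)) ≤ ℕtoℚ (len i) * F i
       -- A charged variable: `g i ≤ g i * pen i`, so the left side is at most 0.
       go (yes 1≤pen) = ≤-trans (subst (_≤ 0ℚ) (neg-flip c (ℕtoℚ (g i)) (ℕtoℚ (g i ℕ.* pen i)))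
                          (neg-antimono-≤ (0≤* 0≤c (p≤q⇒0≤q-p (ℕtoℚ-mono-≤ (ℕₚ.≤-trans (ℕₚ.≤-reflexive (sym (ℕₚ.*-identityʳ (g i)))) (ℕₚ.*-monoʳ-≤ (g i) 1≤pen)))))))
                          (lenF≥0 i)
       -- An uncharged variable lies outside `S` and `R` and conflicts with nothing in `S`, so
       -- adding it to `S` costs only its weight, and Bonferroni costs the factor `θ`.
       go (no 1≰pen) = begin
        c * (ℕtoℚ (g i) - ℕtoℚ (g i ℕ.* pen i))      ≤⟨ *-monoˡ-≤-0≤ 0≤c (p-q≤p (0≤ℕtoℚ (g i ℕ.* pen i))) ⟩
        c * ℕtoℚ (g i)                               ≡⟨ cong (c *_) (ℕtoℚ-homo-* (len i) (ι (C? i))) ⟩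
        c * (ℕtoℚ (len i) * ℕtoℚ (ι (C? i)))         ≡⟨ regroup₅ θ ρ (y S) (ℕtoℚ (len i)) (ℕtoℚ (ι (C? i))) ⟩
        ℕtoℚ (len i) * (θ * (weight i * y S))        ≤⟨ *-monoˡ-≤-0≤ (0≤ℕtoℚ (len i)) (≤-trans (*-monoˡ-≤-0≤ 0≤θ (y-extend-≥ i∉S i#̸S)) (altSum-y-≥ (S ∪ ⁅ i ⁆) R R≤k dis')) ⟩
        ℕtoℚ (len i) * F i                           ∎
        where
        i∉S : i ∉ S
        i∉S i∈S = 1≰pen (penalised i i (m-S i∈S) (e-refl i))
        i#̸S : ∀ s → s ∈ S → ¬ i # s
        i#̸S s s∈S i#s = 1≰pen (penalised i s (m-S s∈S) (e-conf s i i#s))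
        dis' : Disjoint (S ∪ ⁅ i ⁆) R
        dis' j j∈ j∈R with x∈p∪q⁻ S ⁅ i ⁆ j∈
        ... | inj₁ j∈S = dis j j∈S j∈R
        ... | inj₂ j∈i with refl ← x∈⁅y⁆⇒x≡y i j∈i = 1≰pen (penalised i i (m-R j∈R) (e-refl i))

      bound : - b * altSum y S R ≤ ∑ℚ (allFin N) (λ i → ℕtoℚ (len i) * F i)
      bound = go (meet? S R)
       where
       go : Dec (∃ λ i → i ∈ S × i ∈ R) → - b * altSum y S R ≤ ∑ℚ (allFin N) (λ i → ℕtoℚ (len i) * F i)
       go (yes (j , j∈S , j∈R)) = subst (_≤ ∑ℚ (allFin N) (λ i → ℕtoℚ (len i) * F i))
              (trans (∑ℚ-zero (allFin N)) (sym (trans (cong (- b *_) (altSum-meet y j∈S j∈R)) (*-zeroʳ (- b)))))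
              (∑ℚ-mono (allFin N) lenF≥0)
       go (no ¬meet) = begin
        - b * altSum y S R                                                     ≤⟨ *-monoˡ-≤-0≤ 0≤-b (altSum-y-≤ S R R≤k) ⟩
        - b * y S                                                              ≤⟨ *-monoʳ-≤-0≤ (0≤y S) -b≤ ⟩
        θ * (ρ * (ℕtoℚ A - ℕtoℚ (k ℕ.* D))) * y S                              ≡⟨ regroup₄ θ ρ (ℕtoℚ A - ℕtoℚ (k ℕ.* D)) (y S) ⟩
        c * (ℕtoℚ A - ℕtoℚ (k ℕ.* D))                                          ≤⟨ *-monoˡ-≤-0≤ 0≤c (+-mono-≤ (ℕtoℚ-mono-≤ A≤) (neg-antimono-≤ (ℕtoℚ-mono-≤ pen-total))) ⟩
        c * (ℕtoℚ (∑ (allFin N) g) - ℕtoℚ (∑ (allFin N) (λ i → g i ℕ.* pen i))) ≡⟨ cong (c *_) (cong₂ _-_ (∑ℚ-ℕtoℚ (allFin N) g) (∑ℚ-ℕtoℚ (allFin N) _)) ⟨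
        c * (∑ℚ (allFin N) (ℕtoℚ ∘ g) - ∑ℚ (allFin N) (λ i → ℕtoℚ (g i ℕ.* pen i))) ≡⟨ cong (λ t → c * (∑ℚ (allFin N) (ℕtoℚ ∘ g) + t)) (∑ℚ-neg (allFin N) _) ⟨
        c * (∑ℚ (allFin N) (ℕtoℚ ∘ g) + ∑ℚ (allFin N) (λ i → - ℕtoℚ (g i ℕ.* pen i))) ≡⟨ cong (c *_) (∑ℚ-+ (allFin N) _ _) ⟨
        c * ∑ℚ (allFin N) (λ i → ℕtoℚ (g i) - ℕtoℚ (g i ℕ.* pen i))            ≡⟨ ∑ℚ-*ˡ c (allFin N) _ ⟨
        ∑ℚ (allFin N) (λ i → c * (ℕtoℚ (g i) - ℕtoℚ (g i ℕ.* pen i)))          ≤⟨ ∑ℚ-mono (allFin N) (term (λ j j∈S j∈R → ¬meet (j , j∈S , j∈R))) ⟩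
        ∑ℚ (allFin N) (λ i → ℕtoℚ (len i) * F i)                               ∎

-- Reindexing sums over lists, products and initial segments

∑-foldr : ∀ {A : Set} (xs : List A) f → foldr ℕ._+_ 0 (map f xs) ≡ ∑ xs f
∑-foldr []       f = refl
∑-foldr (x ∷ xs) f = cong (f x ℕ.+_) (∑-foldr xs f)

∑-++ : ∀ {A : Set} (xs ys : List A) f → ∑ (xs ++ ys) f ≡ ∑ xs f ℕ.+ ∑ ys f
∑-++ []       ys f = refl
∑-++ (x ∷ xs) ys f = trans (cong (f x ℕ.+_) (∑-++ xs ys f)) (sym (ℕₚ.+-assoc (f x) _ _))

∑-map : ∀ {A B : Set} (g : A → B) (xs : List A) f → ∑ (map g xs) f ≡ ∑ xs (f ∘ g)
∑-map g []       f = refl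
∑-map g (x ∷ xs) f = cong (f (g x) ℕ.+_) (∑-map g xs f)

∑-concatMap : ∀ {A B : Set} (g : A → List B) (xs : List A) f → ∑ (concatMap g xs) f ≡ ∑ xs (λ x → ∑ (g x) f)
∑-concatMap g []       f = refl
∑-concatMap g (x ∷ xs) f = trans (∑-++ (g x) (concatMap g xs) f) (cong (∑ (g x) f ℕ.+_) (∑-concatMap g xs f))

∑-lookup : ∀ {A : Set} (xs : List A) f → ∑ (allFin _) (λ i → f (lookup xs i)) ≡ ∑ xs f
∑-lookup xs f = trans (sym (∑-map (lookup xs) (allFin _) f))
  (cong (λ ys → ∑ ys f) (trans (map-tabulate id (lookup xs)) (tabulate-lookup xs)))

∑-const : ∀ {N} c → ∑ (allFin N) (λ _ → c) ≡ N ℕ.* c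
∑-const {zero}  c = refl
∑-const {suc N} c = trans (∑-allFin-suc {N} (λ _ → c)) (cong (c ℕ.+_) (∑-const {N} c))

∑-Fin-+ : ∀ m n (f : Fin (m ℕ.+ n) → ℕ) →
  ∑ (allFin (m ℕ.+ n)) f ≡ ∑ (allFin m) (λ i → f (i ↑ˡ n)) ℕ.+ ∑ (allFin n) (λ j → f (m ↑ʳ j))
∑-Fin-+ zero    n f = refl
∑-Fin-+ (suc m) n f = begin
  ∑ (allFin (suc m ℕ.+ n)) f                                 ≡⟨ ∑-allFin-suc f ⟩
  f zero ℕ.+ ∑ (allFin (m ℕ.+ n)) (f ∘ suc)                  ≡⟨ cong (f zero ℕ.+_) (∑-Fin-+ m n (f ∘ suc)) ⟩
  f zero ℕ.+ (∑ (allFin m) (λ i → f (suc (i ↑ˡ n))) ℕ.+ rest) ≡⟨ sym (ℕₚ.+-assoc (f zero) _ rest) ⟩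
  f zero ℕ.+ ∑ (allFin m) (λ i → f (suc (i ↑ˡ n))) ℕ.+ rest   ≡⟨ cong (ℕ._+ rest) (sym (∑-allFin-suc (λ i → f (i ↑ˡ n)))) ⟩
  ∑ (allFin (suc m)) (λ i → f (i ↑ˡ n)) ℕ.+ rest              ∎
  where
  open ≡-Reasoning
  rest = ∑ (allFin n) (λ j → f (suc m ↑ʳ j))

∑-Fin-* : ∀ m n (f : Fin (m ℕ.* n) → ℕ) →
  ∑ (allFin (m ℕ.* n)) f ≡ ∑ (allFin m) (λ i → ∑ (allFin n) (λ j → f (combine i j)))
∑-Fin-* zero    n f = refl
∑-Fin-* (suc m) n f = trans (∑-Fin-+ n (m ℕ.* n) f)
  (trans (cong (∑ (allFin n) (λ j → f (j ↑ˡ (m ℕ.* n))) ℕ.+_) (∑-Fin-* m n (λ x → f (n ↑ʳ x))))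
         (sym (∑-allFin-suc {m} (λ i → ∑ (allFin n) (λ j → f (combine i j))))))

∑-upTo-suc : ∀ n f → ∑ (upTo (suc n)) f ≡ f 0 ℕ.+ ∑ (upTo n) (f ∘ suc)
∑-upTo-suc n f = cong (f 0 ℕ.+_) (go id n)
  where
  go : ∀ (h : ℕ → ℕ) m → ∑ (applyUpTo (suc ∘ h) m) f ≡ ∑ (applyUpTo h m) (f ∘ suc)
  go h zero    = refl
  go h (suc m) = cong (f (suc (h 0)) ℕ.+_) (go (h ∘ suc) m)

∑-upTo-allFin : ∀ n f → ∑ (upTo n) f ≡ ∑ (allFin n) (f ∘ toℕ)
∑-upTo-allFin zero    f = refl
∑-upTo-allFin (suc n) f = trans (∑-upTo-suc n f) (trans (cong (f 0 ℕ.+_) (∑-upTo-allFin n (f ∘ suc))) (sym (∑-allFin-suc {n} (f ∘ toℕ))))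

∑-upTo-+ : ∀ m n f → ∑ (upTo (m ℕ.+ n)) f ≡ ∑ (upTo m) f ℕ.+ ∑ (upTo n) (λ u → f (m ℕ.+ u))
∑-upTo-+ zero    n f = refl
∑-upTo-+ (suc m) n f = trans (∑-upTo-suc (m ℕ.+ n) f) (trans (cong (f 0 ℕ.+_) (∑-upTo-+ m n (f ∘ suc)))
  (trans (sym (ℕₚ.+-assoc (f 0) _ _)) (cong (ℕ._+ ∑ (upTo n) (λ u → f (suc m ℕ.+ u))) (sym (∑-upTo-suc m f)))))

∑-upTo-single : ∀ n m f → m ℕ.< n → (∀ u → u ℕ.< n → u ≢ m → f u ≡ 0) → ∑ (upTo n) f ≡ f m
∑-upTo-single (suc n) zero f _ zeros = trans (∑-upTo-suc n f) (trans (cong (f 0 ℕ.+_) (vanish n (f ∘ suc) λ u u<n → zeros (suc u) (s≤s u<n) λ ())) (ℕₚ.+-identityʳ (f 0)))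
  where
  vanish : ∀ n f → (∀ u → u ℕ.< n → f u ≡ 0) → ∑ (upTo n) f ≡ 0
  vanish zero    f zeros = refl
  vanish (suc n) f zeros = trans (∑-upTo-suc n f) (cong₂ ℕ._+_ (zeros 0 (s≤s z≤n)) (vanish n (f ∘ suc) λ u u<n → zeros (suc u) (s≤s u<n)))
∑-upTo-single (suc n) (suc m) f (s≤s m<n) zeros = trans (∑-upTo-suc n f)
  (cong₂ ℕ._+_ (zeros 0 (s≤s z≤n) λ ()) (∑-upTo-single n m (f ∘ suc) m<n λ u u<n u≢m → zeros (suc u) (s≤s u<n) (u≢m ∘ ℕₚ.suc-injective)))

-- Each stretch of `p` consecutive indices contains one multiple, its first; the `suc` in the bound
-- admits the last multiple `l * p`.
∑-multiples : ∀ l p f → 0 ℕ.< p → (∀ u → ¬ p Div.∣ u → f u ≡ 0) →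
  ∑ (upTo (suc (l ℕ.* p))) f ≡ ∑ (upTo (suc l)) (λ a → f (a ℕ.* p))
∑-multiples zero    p f 0<p zeros = refl
∑-multiples (suc l) p f 0<p zeros = begin
  ∑ (upTo (suc (p ℕ.+ l ℕ.* p))) f
    ≡⟨ cong (λ n → ∑ (upTo n) f) (sym (ℕₚ.+-suc p (l ℕ.* p))) ⟩
  ∑ (upTo (p ℕ.+ suc (l ℕ.* p))) f
    ≡⟨ ∑-upTo-+ p (suc (l ℕ.* p)) f ⟩
  ∑ (upTo p) f ℕ.+ ∑ (upTo (suc (l ℕ.* p))) (λ u → f (p ℕ.+ u))
    ≡⟨ cong₂ ℕ._+_ (∑-upTo-single p 0 f 0<p λ u u<p u≢0 → zeros u λ p∣u → ℕₚ.<⇒≱ u<p (Div.∣⇒≤ {{ℕ.≢-nonZero u≢0}} p∣u))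
                   (∑-multiples l p (λ u → f (p ℕ.+ u)) 0<p λ u p∤u → zeros (p ℕ.+ u) λ p∣p+u → p∤u (Div.∣m+n∣m⇒∣n p∣p+u Div.∣-refl)) ⟩
  f 0 ℕ.+ ∑ (upTo (suc l)) (λ a → f (p ℕ.+ a ℕ.* p))
    ≡⟨ sym (∑-upTo-suc (suc l) (λ a → f (a ℕ.* p))) ⟩
  ∑ (upTo (suc (suc l))) (λ a → f (a ℕ.* p)) ∎
  where open ≡-Reasoning

∑-ι≤1 : ∀ {A : Set} {Q : A → Set} (Q? : ∀ x → Dec (Q x)) {xs} → Unique xs →
  (∀ {x y} → Q x → Q y → x ≡ y) → ∑ xs (λ x → ι (Q? x)) ℕ.≤ 1
∑-ι≤1 Q? [] _ = z≤n
∑-ι≤1 {Q = Q} Q? {x ∷ xs} (x∉xs ∷ uniq) unique with Q? x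
... | no  _  = ∑-ι≤1 Q? uniq unique
... | yes Qx = ℕₚ.≤-reflexive (cong suc (vanish x∉xs))
  where
  vanish : ∀ {ys} → All (x ≢_) ys → ∑ ys (λ y → ι (Q? y)) ≡ 0
  vanish []             = refl
  vanish (x≢y ∷ x∉ys) = cong₂ ℕ._+_ (ι-false (Q? _) (x≢y ∘ unique Qx)) (vanish x∉ys)

-- Counting canonical variables

-- One of the aligned full-length slots of the job. The subtraction does not truncate on
-- `variables`, whose starts have the form `r I j + u`.
Canonical : ∀ {n} → Instance n → Fin n × ℕ × ℕ → Set
Canonical I (j , t , q) = q ≡ p I j × p I j Div.∣ t ℕ.∸ r I j

canonical? : ∀ {n} (I : Instance n) v → Dec (Canonical I v)
canonical? I (j , t , q) = q ℕ.≟ p I j ×-dec p I j Div.∣? (t ℕ.∸ r I j)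

-- Only the full length survives among the lengths, and among the offsets from 0 to `l * p I j` only
-- the multiples of `p I j`; a window of `suc l` job lengths therefore has `suc l` slots.
∑-canonical : ∀ {n} (I : Instance n) l → (∀ j → 0 ℕ.< p I j) → (∀ j → d I j ≡ r I j ℕ.+ suc l ℕ.* p I j) → ∀ (g : Fin n × ℕ × ℕ → ℕ) →
  ∑ (variables I) (λ v → g v ℕ.* ι (canonical? I v)) ≡
  ∑ (allFin n) (λ j → ∑ (allFin (suc l)) (λ a → g (j , r I j ℕ.+ toℕ a ℕ.* p I j , p I j)))
∑-canonical {n} I l 0<p d≡ g = trans (∑-concatMap _ (allFin n) f) (∑-cong (allFin n) λ j →
  trans (∑-concatMap _ (upTo (p I j)) f) (trans (∑-cong (upTo (p I j)) λ q → ∑-map (λ u → j , r I j ℕ.+ u , suc q) (upTo (suc (d I j ℕ.∸ suc q ℕ.∸ r I j))) f) (perJob j (p I j) refl (0<p j))))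
  where
  f : Fin n × ℕ × ℕ → ℕ
  f v = g v ℕ.* ι (canonical? I v)
  f-canonical : ∀ v → Canonical I v → f v ≡ g v
  f-canonical v c = trans (cong (g v ℕ.*_) (ι-true (canonical? I v) c)) (ℕₚ.*-identityʳ (g v))
  f-other : ∀ v → ¬ Canonical I v → f v ≡ 0
  f-other v ¬c = trans (cong (g v ℕ.*_) (ι-false (canonical? I v) ¬c)) (ℕₚ.*-zeroʳ (g v))

  -- The size is passed as a separate `P`, which can be matched as a successor while `p I j` cannot.
  perJob : ∀ j P → P ≡ p I j → 0 ℕ.< P →
    ∑ (upTo P) (λ q → ∑ (upTo (suc (d I j ℕ.∸ suc q ℕ.∸ r I j))) (λ u → f (j , r I j ℕ.+ u , suc q))) ≡
    ∑ (allFin (suc l)) (λ a → g (j , r I j ℕ.+ toℕ a ℕ.* P , P))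
  perJob j (suc p-1) P≡p 0<P = begin
    ∑ (upTo (suc p-1)) (λ q → ∑ (upTo (suc (d I j ℕ.∸ suc q ℕ.∸ r I j))) (λ u → f (j , r I j ℕ.+ u , suc q)))
      ≡⟨ ∑-upTo-single (suc p-1) p-1 _ ℕₚ.≤-refl (λ q _ q≢ → trans (∑-cong (upTo (suc (d I j ℕ.∸ suc q ℕ.∸ r I j))) λ u → f-other (j , r I j ℕ.+ u , suc q) λ c → q≢ (ℕₚ.suc-injective (trans (proj₁ c) (sym P≡p)))) (∑-zero (upTo (suc (d I j ℕ.∸ suc q ℕ.∸ r I j))))) ⟩
    ∑ (upTo (suc (d I j ℕ.∸ P ℕ.∸ r I j))) (λ u → f (j , r I j ℕ.+ u , P))
      ≡⟨ cong (λ m → ∑ (upTo (suc m)) (λ u → f (j , r I j ℕ.+ u , P))) slots ⟩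
    ∑ (upTo (suc (l ℕ.* P))) (λ u → f (j , r I j ℕ.+ u , P))
      ≡⟨ ∑-multiples l P _ 0<P (λ u P∤u → f-other (j , r I j ℕ.+ u , P) λ c → P∤u (subst₂ Div._∣_ (sym P≡p) (ℕₚ.m+n∸m≡n (r I j) u) (proj₂ c))) ⟩
    ∑ (upTo (suc l)) (λ a → f (j , r I j ℕ.+ a ℕ.* P , P))
      ≡⟨ ∑-cong (upTo (suc l)) (λ a → f-canonical (j , r I j ℕ.+ a ℕ.* P , P) (P≡p , subst₂ Div._∣_ P≡p (sym (ℕₚ.m+n∸m≡n (r I j) (a ℕ.* P))) (Div.n∣m*n a))) ⟩
    ∑ (upTo (suc l)) (λ a → g (j , r I j ℕ.+ a ℕ.* P , P))
      ≡⟨ ∑-upTo-allFin (suc l) _ ⟩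
    ∑ (allFin (suc l)) (λ a → g (j , r I j ℕ.+ toℕ a ℕ.* P , P)) ∎
    where
    open ≡-Reasoning
    P = suc p-1
    slots : d I j ℕ.∸ P ℕ.∸ r I j ≡ l ℕ.* P
    slots = begin
      d I j ℕ.∸ P ℕ.∸ r I j                         ≡⟨ ℕₚ.∸-+-assoc (d I j) P (r I j) ⟩
      d I j ℕ.∸ (P ℕ.+ r I j)                       ≡⟨ cong₂ ℕ._∸_ (trans (d≡ j) (trans (cong (λ q → r I j ℕ.+ (q ℕ.+ l ℕ.* q)) (sym P≡p)) (sym (ℕₚ.+-assoc (r I j) P (l ℕ.* P))))) (ℕₚ.+-comm P (r I j)) ⟩
      r I j ℕ.+ P ℕ.+ l ℕ.* P ℕ.∸ (r I j ℕ.+ P)     ≡⟨ ℕₚ.m+n∸m≡n (r I j ℕ.+ P) (l ℕ.* P) ⟩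
      l ℕ.* P                                       ∎

-- Whole grid cells inside an interval

m≤n+m/n*n : ∀ m n .{{_ : ℕ.NonZero n}} → m ℕ.≤ n ℕ.+ m ℕ./ n ℕ.* n
m≤n+m/n*n m n = ℕₚ.≤-trans (ℕₚ.≤-reflexive (m≡m%n+[m/n]*n m n)) (ℕₚ.+-monoˡ-≤ (m ℕ./ n ℕ.* n) (ℕₚ.<⇒≤ (m%n<n m n)))

WithinCell : ℕ → ℕ → ℕ → ℕ → Set
WithinCell L s e W = s ℕ.≤ W ℕ.* L × W ℕ.* L ℕ.+ L ℕ.≤ e

within? : ∀ L s e W → Dec (WithinCell L s e W)
within? L s e W = s ℕ.≤? W ℕ.* L ×-dec W ℕ.* L ℕ.+ L ℕ.≤? e

-- All but the two extreme grid cells met by [s , e] lie inside it.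
∑-within≥ : ∀ L .{{_ : ℕ.NonZero L}} M s e → e ℕ.≤ M ℕ.* L →
  e ℕ.≤ s ℕ.+ (L ℕ.+ L) ℕ.+ L ℕ.* ∑ (allFin M) (λ W → ι (within? L s e (toℕ W)))
∑-within≥ L M s e e≤ML with ℕₚ.≤-total (e ℕ./ L) (suc (s ℕ./ L))
-- If `e` lies no further than the cell after that of `s`, the slack `L + L` alone suffices.
... | inj₁ q≤a = begin
  e                                  ≤⟨ m≤n+m/n*n e L ⟩
  L ℕ.+ e ℕ./ L ℕ.* L                    ≤⟨ ℕₚ.+-monoʳ-≤ L (ℕₚ.*-monoˡ-≤ L q≤a) ⟩
  L ℕ.+ (L ℕ.+ s ℕ./ L ℕ.* L)              ≤⟨ ℕₚ.+-monoʳ-≤ L (ℕₚ.+-monoʳ-≤ L (m/n*n≤m s L)) ⟩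
  L ℕ.+ (L ℕ.+ s)                        ≡⟨ comm L s ⟩
  s ℕ.+ (L ℕ.+ L)                        ≤⟨ ℕₚ.m≤m+n _ _ ⟩
  _                                  ∎
  where
  open ℕₚ.≤-Reasoning
  comm : ∀ L s → L ℕ.+ (L ℕ.+ s) ≡ s ℕ.+ (L ℕ.+ L)
  comm = ℕSolver.solve-∀
... | inj₂ a≤q = begin
  e                                  ≤⟨ m≤n+m/n*n e L ⟩
  L ℕ.+ e ℕ./ L ℕ.* L                    ≡⟨ cong (λ q → L ℕ.+ q ℕ.* L) (sym a+b≡q) ⟩
  L ℕ.+ (suc (s ℕ./ L) ℕ.+ b) ℕ.* L        ≡⟨ expand L (s ℕ./ L) b ⟩
  s ℕ./ L ℕ.* L ℕ.+ (L ℕ.+ L) ℕ.+ L ℕ.* b      ≤⟨ ℕₚ.+-mono-≤ (ℕₚ.+-monoˡ-≤ (L ℕ.+ L) (m/n*n≤m s L)) (ℕₚ.*-monoʳ-≤ L b≤∑) ⟩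
  s ℕ.+ (L ℕ.+ L) ℕ.+ L ℕ.* ∑ (allFin M) (λ W → ι (within? L s e (toℕ W))) ∎
  where
  open ℕₚ.≤-Reasoning
  a b c : ℕ
  -- The `b` cells from `a` up to just before `e / L` are inside for sure, and `c` counts the cells
  -- from `e / L` on. When `s` is a multiple of `L` one whole cell is passed over, which the slack
  -- absorbs.
  a = suc (s ℕ./ L)
  b = e ℕ./ L ℕ.∸ a
  c = M ℕ.∸ e ℕ./ L
  a+b≡q : a ℕ.+ b ≡ e ℕ./ L
  a+b≡q = ℕₚ.m+[n∸m]≡n a≤q
  q≤M : e ℕ./ L ℕ.≤ M
  q≤M = ℕₚ.*-cancelʳ-≤ (e ℕ./ L) M L (ℕₚ.≤-trans (m/n*n≤m e L) e≤ML)
  expand : ∀ L q b → L ℕ.+ (suc q ℕ.+ b) ℕ.* L ≡ q ℕ.* L ℕ.+ (L ℕ.+ L) ℕ.+ L ℕ.* b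
  expand = ℕSolver.solve-∀
  f : ℕ → ℕ
  f W = ι (within? L s e W)
  within : ∀ (u : Fin b) → WithinCell L s e (a ℕ.+ toℕ u)
  within u =
    ℕₚ.≤-trans (m≤n+m/n*n s L) (ℕₚ.*-monoˡ-≤ L (ℕₚ.m≤m+n a (toℕ u))) ,
    ℕₚ.≤-trans (ℕₚ.≤-reflexive (ℕₚ.+-comm ((a ℕ.+ toℕ u) ℕ.* L) L))
      (ℕₚ.≤-trans (ℕₚ.*-monoˡ-≤ L (ℕₚ.≤-trans (ℕₚ.≤-reflexive (sym (ℕₚ.+-suc a (toℕ u)))) (ℕₚ.≤-trans (ℕₚ.+-monoʳ-≤ a (Finₚ.toℕ<n u)) (ℕₚ.≤-reflexive a+b≡q))))
                 (m/n*n≤m e L))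
  b≤∑ : b ℕ.≤ ∑ (allFin M) (f ∘ toℕ)
  b≤∑ = begin
    b                                                      ≡⟨ sym (trans (∑-const {b} 1) (ℕₚ.*-identityʳ b)) ⟩
    ∑ (allFin b) (λ _ → 1)                                 ≡⟨ ∑-cong (allFin b) (λ u → sym (ι-true (within? L s e (a ℕ.+ toℕ u)) (within u))) ⟩
    ∑ (allFin b) (λ u → f (a ℕ.+ toℕ u))                     ≡⟨ ∑-upTo-allFin b (λ u → f (a ℕ.+ u)) ⟨
    ∑ (upTo b) (λ u → f (a ℕ.+ u))                           ≤⟨ ℕₚ.m≤n+m _ _ ⟩
    ∑ (upTo a) f ℕ.+ ∑ (upTo b) (λ u → f (a ℕ.+ u))            ≡⟨ ∑-upTo-+ a b f ⟨
    ∑ (upTo (a ℕ.+ b)) f                                     ≤⟨ ℕₚ.m≤m+n _ _ ⟩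
    ∑ (upTo (a ℕ.+ b)) f ℕ.+ ∑ (upTo c) (λ u → f (a ℕ.+ b ℕ.+ u))  ≡⟨ ∑-upTo-+ (a ℕ.+ b) c f ⟨
    ∑ (upTo (a ℕ.+ b ℕ.+ c)) f                                 ≡⟨ cong (λ m → ∑ (upTo m) f) (trans (cong (ℕ._+ c) a+b≡q) (ℕₚ.m+[n∸m]≡n q≤M)) ⟩
    ∑ (upTo M) f                                           ≡⟨ ∑-upTo-allFin M f ⟩
    ∑ (allFin M) (f ∘ toℕ)                                 ∎

maxFinℕ-≤ : ∀ {N} (f : Fin N → ℕ) {m} → (∀ i → f i ℕ.≤ m) → maxFinℕ f ℕ.≤ m
maxFinℕ-≤ {N} f {m} f≤m = go (allFin N)
  where
  go : ∀ xs → foldr ℕ._⊔_ 0 (map f xs) ℕ.≤ m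
  go []       = z≤n
  go (x ∷ xs) = ℕₚ.⊔-lub (f≤m x) (go xs)

-- The instance

module Construction (g : ℕ) where

  h L P T n : ℕ
  -- A successor, so that division by `L` and `P` is defined and the first job is long.
  h = suc g
  L = h ℕ.+ h
  -- A long job may waste `L + L` at its two ends. With `P` ten times `L` this is a fifth of `P`,
  -- which lowers the bound T/4 to exactly T/5.
  P = 10 ℕ.* L
  T = P ℕ.* L
  n = h ℕ.+ P ℕ.* h

  -- nothing: a long job; just W: a unit job of cell W
  cell : Fin n → Maybe (Fin P)
  cell j = [ (λ _ → nothing) , just ∘ quotient h ]′ (splitAt h j)

  size release deadline : Maybe (Fin P) → ℕ
  size     = maybe′ (λ _ → 1) P
  release  = maybe′ (λ W → toℕ W ℕ.* L) 0
  deadline = maybe′ (λ W → toℕ W ℕ.* L ℕ.+ L) T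

  I : Instance n
  I = record { p = size ∘ cell ; r = release ∘ cell ; d = deadline ∘ cell }

  long : Fin h → Fin n
  long x = x ↑ˡ (P ℕ.* h)

  unit : Fin P → Fin h → Fin n
  unit W c = h ↑ʳ combine W c

  cell-long : ∀ x → cell (long x) ≡ nothing
  cell-long x = cong [ (λ _ → nothing) , just ∘ quotient h ]′ (Finₚ.splitAt-↑ˡ h x (P ℕ.* h))

  cell-unit : ∀ W c → cell (unit W c) ≡ just W
  cell-unit W c = trans (cong [ (λ _ → nothing) , just ∘ quotient h ]′ (Finₚ.splitAt-↑ʳ h (P ℕ.* h) (combine W c)))
                        (cong (just ∘ proj₁) (Finₚ.remQuot-combine W c))

  ∑-jobs : ∀ (f : Fin n → ℕ) → ∑ (allFin n) f ≡
    ∑ (allFin h) (f ∘ long) ℕ.+ ∑ (allFin P) (λ W → ∑ (allFin h) (λ c → f (unit W c)))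
  ∑-jobs f = trans (∑-Fin-+ h (P ℕ.* h) f) (cong (∑ (allFin h) (f ∘ long) ℕ.+_) (∑-Fin-* P h (λ b → f (h ↑ʳ b))))

  ∑-cells : ∀ (f : Maybe (Fin P) → ℕ) →
    ∑ (allFin n) (f ∘ cell) ≡ h ℕ.* f nothing ℕ.+ h ℕ.* ∑ (allFin P) (f ∘ just)
  ∑-cells f = trans (∑-jobs (f ∘ cell)) (cong₂ ℕ._+_
    (trans (∑-cong (allFin h) λ x → cong f (cell-long x)) (∑-const {h} (f nothing)))
    (trans (∑-cong (allFin P) λ W → trans (∑-cong (allFin h) λ c → cong f (cell-unit W c)) (∑-const {h} (f (just W))))
           (∑-*ˡ h (allFin P) (f ∘ just))))

  0<size : ∀ κ → 0 ℕ.< size κ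
  0<size (just _) = s≤s z≤n
  0<size nothing  = s≤s z≤n

  size≤P : ∀ κ → size κ ℕ.≤ P
  size≤P (just _) = s≤s z≤n
  size≤P nothing  = ℕₚ.≤-refl

  -- Every window is `L` times as long as its job, so all jobs have exactly `L` aligned slots.
  deadline-release : ∀ κ → deadline κ ≡ release κ ℕ.+ L ℕ.* size κ
  deadline-release (just W) = cong (toℕ W ℕ.* L ℕ.+_) (sym (ℕₚ.*-identityʳ L))
  deadline-release nothing  = ℕₚ.*-comm P L

  deadline≤T : ∀ κ → deadline κ ℕ.≤ T
  deadline≤T (just W) = ℕₚ.≤-trans (ℕₚ.≤-reflexive (ℕₚ.+-comm (toℕ W ℕ.* L) L)) (ℕₚ.*-monoˡ-≤ L (Finₚ.toℕ<n W))
  deadline≤T nothing  = ℕₚ.≤-refl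

  valid : ValidInstance I
  valid j = 0<size (cell j) , ℕₚ.≤-trans (ℕₚ.+-monoʳ-≤ (release (cell j)) (ℕₚ.m≤n*m (size (cell j)) L)) (ℕₚ.≤-reflexive (sym (deadline-release (cell j))))

  totalSize≡T : totalSize I ≡ T
  totalSize≡T = trans (∑-foldr (allFin n) (p I)) (trans (∑-cells size)
    (trans (cong (λ t → h ℕ.* P ℕ.+ h ℕ.* t) (trans (∑-const {P} 1) (ℕₚ.*-identityʳ P))) (eq h P)))
    where
    eq : ∀ h P → h ℕ.* P ℕ.+ h ℕ.* P ≡ P ℕ.* (h ℕ.+ h)
    eq = ℕSolver.solve-∀

  maxDeadline≡T : maxDeadline I ≡ T
  -- Job `zero` is long, so the maximum starts with `T`.
  maxDeadline≡T = ℕₚ.≤-antisym (maxFinℕ-≤ (d I) (deadline≤T ∘ cell)) (ℕₚ.m≤m⊔n T (foldr ℕ._⊔_ 0 (map (d I) (tabulate suc))))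

  -- The cost is counted in two parts: the lengths `cut` from the long jobs, and the `h` unit jobs
  -- of each cell that a long job swallows whole (`hit`). The factor 5 expresses 0.2.
  cost≥ : ∀ (s : Solution I) → totalSize I ℕ.≤ 5 ℕ.* cost s
  cost≥ s = ℕₚ.≤-trans (ℕₚ.≤-reflexive totalSize≡T) (arith h (∑ (allFin h) cut) (∑ (allFin h) hit) (cost s) perLong-sum cost-split)
    where
    open ℕₚ.≤-Reasoning hiding (start)
    a e : Fin h → ℕ
    a x = start s (long x)
    e x = start s (long x) ℕ.+ len s (long x)
    Hit : Fin P → Fin h → Set
    Hit W x = WithinCell L (a x) (e x) (toℕ W)
    hit? : ∀ W x → Dec (Hit W x)
    hit? W x = within? L (a x) (e x) (toℕ W)
    cut hit : Fin h → ℕ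
    cut x = P ℕ.∸ len s (long x)
    hit x = ∑ (allFin P) (λ W → ι (hit? W x))

    len-long≤P : ∀ x → len s (long x) ℕ.≤ P
    len-long≤P x = ℕₚ.≤-trans (len≤p s (long x)) (size≤P (cell (long x)))

    -- A cell has positive length, so a job containing one is processed; `disjoint` speaks of
    -- processed jobs only.
    hit⇒0<len : ∀ {W x} → Hit W x → 0 ℕ.< len s (long x)
    hit⇒0<len {W} {x} (lo , hi) = ℕₚ.+-cancelˡ-< (a x) 0 _ (begin-strict
      a x ℕ.+ 0             ≡⟨ ℕₚ.+-identityʳ (a x) ⟩
      a x                 ≤⟨ lo ⟩
      toℕ W ℕ.* L           <⟨ ℕₚ.m<m+n (toℕ W ℕ.* L) (s≤s z≤n) ⟩
      toℕ W ℕ.* L ℕ.+ L       ≤⟨ hi ⟩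
      e x                 ∎)

    -- Two intervals that both contain the nonempty (u, v] cannot follow one another. This serves
    -- both for two long jobs on one cell and for a unit job under a long one.
    nested⇒overlap : ∀ {lo₁ hi₁ lo₂ hi₂ u v} → lo₁ ℕ.≤ u → v ℕ.≤ hi₁ → lo₂ ℕ.≤ u → v ℕ.≤ hi₂ → u ℕ.< v → ¬ (hi₁ ℕ.≤ lo₂ ⊎ hi₂ ℕ.≤ lo₁)
    nested⇒overlap lo₁ hi₁ lo₂ hi₂ u<v (inj₁ sep) = ℕₚ.<⇒≱ u<v (ℕₚ.≤-trans hi₁ (ℕₚ.≤-trans sep lo₂))
    nested⇒overlap lo₁ hi₁ lo₂ hi₂ u<v (inj₂ sep) = ℕₚ.<⇒≱ u<v (ℕₚ.≤-trans hi₂ (ℕₚ.≤-trans sep lo₁))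

    hit-unique : ∀ {W x y} → Hit W x → Hit W y → x ≡ y
    hit-unique {W} {x} {y} Hx Hy with x Fin.≟ y
    ... | yes x≡y = x≡y
    ... | no  x≢y = ⊥-elim (nested⇒overlap (proj₁ Hx) (proj₂ Hx) (proj₁ Hy) (proj₂ Hy) (ℕₚ.m<m+n (toℕ W ℕ.* L) (s≤s z≤n))
                      (disjoint s (long x) (long y) (x≢y ∘ Finₚ.↑ˡ-injective (P ℕ.* h) x y) (hit⇒0<len {W} Hx) (hit⇒0<len {W} Hy)))

    long≢unit : ∀ x W c → long x ≢ unit W c
    long≢unit x W c eq with () ← trans (sym (cell-long x)) (trans (cong cell eq) (cell-unit W c))

    hit⇒idle : ∀ {W x} c → Hit W x → ¬ 0 ℕ.< len s (unit W c)
    hit⇒idle {W} {x} c Hx 0<len = nested⇒overlap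
      (ℕₚ.≤-trans (proj₁ Hx) lo) (ℕₚ.≤-trans hi (proj₂ Hx)) ℕₚ.≤-refl ℕₚ.≤-refl
      (ℕₚ.m<m+n (start s (unit W c)) 0<len)
      (disjoint s (long x) (unit W c) (long≢unit x W c) (hit⇒0<len {W} Hx) 0<len)
      where
      lo : toℕ W ℕ.* L ℕ.≤ start s (unit W c)
      lo = subst (λ κ → release κ ℕ.≤ start s (unit W c)) (cell-unit W c) (proj₁ (window s (unit W c) 0<len))
      hi : start s (unit W c) ℕ.+ len s (unit W c) ℕ.≤ toℕ W ℕ.* L ℕ.+ L
      hi = subst (λ κ → start s (unit W c) ℕ.+ len s (unit W c) ℕ.≤ deadline κ) (cell-unit W c) (proj₂ (window s (unit W c) 0<len))

    -- A running unit job rules out all hits of its cell; an idle one loses its length 1, which pays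
    -- for the only long job that can hit the cell.
    idle-units : ∀ W c → ∑ (allFin h) (λ x → ι (hit? W x)) ℕ.≤ p I (unit W c) ℕ.∸ len s (unit W c)
    idle-units W c = go (0 ℕ.<? len s (unit W c))
      where
      go : Dec (0 ℕ.< len s (unit W c)) → ∑ (allFin h) (λ x → ι (hit? W x)) ℕ.≤ p I (unit W c) ℕ.∸ len s (unit W c)
      go (yes 0<len) = ℕₚ.≤-trans (ℕₚ.≤-reflexive (trans (∑-cong (allFin h) λ x → ι-false (hit? W x) λ Hx → hit⇒idle {W} c Hx 0<len) (∑-zero (allFin h)))) z≤n
      go (no idle)   = ℕₚ.≤-trans (∑-ι≤1 (hit? W) (allFin⁺ h) (hit-unique {W}))
        (ℕₚ.≤-reflexive (sym (cong₂ ℕ._∸_ (cong size (cell-unit W c)) (ℕₚ.n≤0⇒n≡0 (ℕₚ.≮⇒≥ idle)))))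

    cost-split : ∑ (allFin h) cut ℕ.+ h ℕ.* ∑ (allFin h) hit ℕ.≤ cost s
    cost-split = begin
      ∑ (allFin h) cut ℕ.+ h ℕ.* ∑ (allFin h) hit
        ≡⟨ cong (λ t → ∑ (allFin h) cut ℕ.+ h ℕ.* t) (∑-swap (allFin h) (allFin P) (λ x W → ι (hit? W x))) ⟩
      ∑ (allFin h) cut ℕ.+ h ℕ.* ∑ (allFin P) (λ W → ∑ (allFin h) (λ x → ι (hit? W x)))
        ≡⟨ cong (∑ (allFin h) cut ℕ.+_) (trans (sym (∑-*ˡ h (allFin P) _)) (∑-cong (allFin P) λ W → sym (∑-const {h} _))) ⟩
      ∑ (allFin h) cut ℕ.+ ∑ (allFin P) (λ W → ∑ (allFin h) (λ c → ∑ (allFin h) (λ x → ι (hit? W x))))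
        ≤⟨ ℕₚ.+-mono-≤ (ℕₚ.≤-reflexive (∑-cong (allFin h) λ x → cong (λ κ → size κ ℕ.∸ len s (long x)) (sym (cell-long x))))
                       (∑-mono (allFin P) λ W → ∑-mono (allFin h) (idle-units W)) ⟩
      ∑ (allFin h) (λ x → p I (long x) ℕ.∸ len s (long x)) ℕ.+ ∑ (allFin P) (λ W → ∑ (allFin h) (λ c → p I (unit W c) ℕ.∸ len s (unit W c)))
        ≡⟨ trans (∑-foldr (allFin n) _) (∑-jobs (λ j → p I j ℕ.∸ len s j)) ⟨
      cost s ∎

    len≤ : ∀ x → len s (long x) ℕ.≤ (L ℕ.+ L) ℕ.+ L ℕ.* hit x
    len≤ x = go (0 ℕ.<? len s (long x))
      where
      go : Dec (0 ℕ.< len s (long x)) → len s (long x) ℕ.≤ (L ℕ.+ L) ℕ.+ L ℕ.* hit x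
      go (no idle)   = ℕₚ.≤-trans (ℕₚ.≮⇒≥ idle) z≤n
      go (yes 0<len) = ℕₚ.+-cancelˡ-≤ (a x) _ _ (begin
        e x                               ≤⟨ ∑-within≥ L P (a x) (e x) (ℕₚ.≤-trans (proj₂ (window s (long x) 0<len)) (deadline≤T (cell (long x)))) ⟩
        a x ℕ.+ (L ℕ.+ L) ℕ.+ L ℕ.* hit x         ≡⟨ ℕₚ.+-assoc (a x) (L ℕ.+ L) (L ℕ.* hit x) ⟩
        a x ℕ.+ ((L ℕ.+ L) ℕ.+ L ℕ.* hit x)       ∎)

    -- The cut is doubled so that, with `L` equal to 2h, the sum over the long jobs contains exactly
    -- twice the quantity bounded in `cost-split`.
    perLong : ∀ x → P ℕ.≤ 2 ℕ.* cut x ℕ.+ ((L ℕ.+ L) ℕ.+ L ℕ.* hit x)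
    perLong x = begin
      P                                     ≡⟨ ℕₚ.m∸n+n≡m (len-long≤P x) ⟨
      cut x ℕ.+ len s (long x)                ≤⟨ ℕₚ.+-mono-≤ (ℕₚ.m≤m+n (cut x) _) (len≤ x) ⟩
      2 ℕ.* cut x ℕ.+ ((L ℕ.+ L) ℕ.+ L ℕ.* hit x)     ∎

    perLong-sum : h ℕ.* P ℕ.≤ 2 ℕ.* ∑ (allFin h) cut ℕ.+ (h ℕ.* (L ℕ.+ L) ℕ.+ L ℕ.* ∑ (allFin h) hit)
    perLong-sum = begin
      h ℕ.* P                                                            ≡⟨ ∑-const {h} P ⟨
      ∑ (allFin h) (λ _ → P)                                           ≤⟨ ∑-mono (allFin h) perLong ⟩
      ∑ (allFin h) (λ x → 2 ℕ.* cut x ℕ.+ ((L ℕ.+ L) ℕ.+ L ℕ.* hit x))           ≡⟨ ∑-+ (allFin h) (λ x → 2 ℕ.* cut x) (λ x → (L ℕ.+ L) ℕ.+ L ℕ.* hit x) ⟩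
      ∑ (allFin h) (λ x → 2 ℕ.* cut x) ℕ.+ ∑ (allFin h) (λ x → (L ℕ.+ L) ℕ.+ L ℕ.* hit x)
        ≡⟨ cong₂ ℕ._+_ (∑-*ˡ 2 (allFin h) cut) (trans (∑-+ (allFin h) (λ _ → L ℕ.+ L) (λ x → L ℕ.* hit x)) (cong₂ ℕ._+_ (∑-const {h} (L ℕ.+ L)) (∑-*ˡ L (allFin h) hit))) ⟩
      2 ℕ.* ∑ (allFin h) cut ℕ.+ (h ℕ.* (L ℕ.+ L) ℕ.+ L ℕ.* ∑ (allFin h) hit)      ∎

    arith : ∀ h A B c → h ℕ.* (10 ℕ.* (h ℕ.+ h)) ℕ.≤ 2 ℕ.* A ℕ.+ (h ℕ.* (h ℕ.+ h ℕ.+ (h ℕ.+ h)) ℕ.+ (h ℕ.+ h) ℕ.* B) → A ℕ.+ h ℕ.* B ℕ.≤ c →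
            10 ℕ.* (h ℕ.+ h) ℕ.* (h ℕ.+ h) ℕ.≤ 5 ℕ.* c
    -- The 20h² is five times the total slack `h * (L + L)`, kept on both sides because subtraction
    -- on the naturals truncates.
    arith h A B c le₁ le₂ = ℕₚ.*-cancelˡ-≤ 2 (ℕₚ.+-cancelʳ-≤ (20 ℕ.* (h ℕ.* h)) _ _ (begin
      2 ℕ.* (10 ℕ.* (h ℕ.+ h) ℕ.* (h ℕ.+ h)) ℕ.+ 20 ℕ.* (h ℕ.* h)                            ≡⟨ eq₁ h ⟩
      5 ℕ.* (h ℕ.* (10 ℕ.* (h ℕ.+ h)))                                               ≤⟨ ℕₚ.*-monoʳ-≤ 5 le₁ ⟩
      5 ℕ.* (2 ℕ.* A ℕ.+ (h ℕ.* (h ℕ.+ h ℕ.+ (h ℕ.+ h)) ℕ.+ (h ℕ.+ h) ℕ.* B))                    ≡⟨ eq₂ h A B ⟩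
      10 ℕ.* (A ℕ.+ h ℕ.* B) ℕ.+ 20 ℕ.* (h ℕ.* h)                                        ≤⟨ ℕₚ.+-monoˡ-≤ (20 ℕ.* (h ℕ.* h)) (ℕₚ.*-monoʳ-≤ 10 le₂) ⟩
      10 ℕ.* c ℕ.+ 20 ℕ.* (h ℕ.* h)                                                  ≡⟨ cong (ℕ._+ 20 ℕ.* (h ℕ.* h)) (ℕₚ.*-assoc 2 5 c) ⟩
      2 ℕ.* (5 ℕ.* c) ℕ.+ 20 ℕ.* (h ℕ.* h)                                             ∎))
      where
      eq₁ : ∀ h → 2 ℕ.* (10 ℕ.* (h ℕ.+ h) ℕ.* (h ℕ.+ h)) ℕ.+ 20 ℕ.* (h ℕ.* h) ≡ 5 ℕ.* (h ℕ.* (10 ℕ.* (h ℕ.+ h)))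
      eq₁ = ℕSolver.solve-∀
      eq₂ : ∀ h A B → 5 ℕ.* (2 ℕ.* A ℕ.+ (h ℕ.* (h ℕ.+ h ℕ.+ (h ℕ.+ h)) ℕ.+ (h ℕ.+ h) ℕ.* B)) ≡ 10 ℕ.* (A ℕ.+ h ℕ.* B) ℕ.+ 20 ℕ.* (h ℕ.* h)
      eq₂ = ℕSolver.solve-∀

-- Aligned slots and time blocks

∈-block⇒/≡ : ∀ a P u .{{_ : ℕ.NonZero P}} → a ℕ.* P ℕ.≤ u → u ℕ.< a ℕ.* P ℕ.+ P → u ℕ./ P ≡ a
∈-block⇒/≡ a P u lo hi = ℕₚ.≤-antisym
  (ℕₚ.≤-pred (m<n*o⇒m/o<n (ℕₚ.≤-trans hi (ℕₚ.≤-reflexive (ℕₚ.+-comm (a ℕ.* P) P)))))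
  (ℕₚ.≤-trans (ℕₚ.≤-reflexive (sym (m*n/n≡m a P))) (/-monoˡ-≤ P lo))

-- Were `b < a`, slot `b` would end no later than slot `a` starts. Used in both directions, this
-- makes the slots of one job disjoint.
slot-≤ : ∀ r p {a b t} → r ℕ.+ a ℕ.* p ℕ.< t → t ℕ.≤ r ℕ.+ b ℕ.* p ℕ.+ p → a ℕ.≤ b
slot-≤ r p {a} {b} lo hi = ℕₚ.≮⇒≥ λ b<a → ℕₚ.<⇒≱ lo (ℕₚ.≤-trans hi
  (ℕₚ.≤-trans (ℕₚ.≤-reflexive (trans (ℕₚ.+-assoc r (b ℕ.* p) p) (cong (r ℕ.+_) (ℕₚ.+-comm (b ℕ.* p) p))))
              (ℕₚ.+-monoʳ-≤ r (ℕₚ.*-monoˡ-≤ p b<a))))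

Covers : ℕ → ℕ → ℕ → Set
Covers t q t′ = t ℕ.< t′ × t′ ℕ.≤ t ℕ.+ q

covers? : ∀ t q t′ → Dec (Covers t q t′)
covers? t q t′ = t ℕ.<? t′ ×-dec t′ ℕ.≤? t ℕ.+ q

∑-slots≤1 : ∀ N r p t → ∑ (allFin N) (λ a → ι (covers? (r ℕ.+ toℕ a ℕ.* p) p t)) ℕ.≤ 1
∑-slots≤1 N r p t = ∑-ι≤1 (λ a → covers? (r ℕ.+ toℕ a ℕ.* p) p t) (allFin⁺ N)
  (λ (lo₁ , hi₁) (lo₂ , hi₂) → Finₚ.toℕ-injective (ℕₚ.≤-antisym (slot-≤ r p lo₁ hi₂) (slot-≤ r p lo₂ hi₁)))

∑-block≤ : ∀ N P b .{{_ : ℕ.NonZero P}} → ∑ (upTo (N ℕ.* P)) (λ u → ι (u ℕ./ P ℕ.≟ b)) ℕ.≤ P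
∑-block≤ N P b = begin
  ∑ (upTo (N ℕ.* P)) (λ u → ι (u ℕ./ P ℕ.≟ b))                                       ≡⟨ ∑-upTo-allFin (N ℕ.* P) _ ⟩
  ∑ (allFin (N ℕ.* P)) (λ u → ι (toℕ u ℕ./ P ℕ.≟ b))                                 ≡⟨ ∑-Fin-* N P (λ u → ι (toℕ u ℕ./ P ℕ.≟ b)) ⟩
  ∑ (allFin N) (λ c → ∑ (allFin P) (λ x → ι (toℕ (combine c x) ℕ./ P ℕ.≟ b)))      ≡⟨ ∑-cong (allFin N) (λ c → ∑-cong (allFin P) (λ x → cong (λ q → ι (q ℕ.≟ b)) (block c x))) ⟩
  ∑ (allFin N) (λ c → ∑ (allFin P) (λ x → ι (toℕ c ℕ.≟ b)))                        ≡⟨ ∑-cong (allFin N) (λ c → ∑-const {P} (ι (toℕ c ℕ.≟ b))) ⟩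
  ∑ (allFin N) (λ c → P ℕ.* ι (toℕ c ℕ.≟ b))                                         ≡⟨ ∑-*ˡ P (allFin N) _ ⟩
  P ℕ.* ∑ (allFin N) (λ c → ι (toℕ c ℕ.≟ b))                                         ≤⟨ ℕₚ.*-monoʳ-≤ P (∑-ι≤1 (λ c → toℕ c ℕ.≟ b) (allFin⁺ N) (λ c≡b c′≡b → Finₚ.toℕ-injective (trans c≡b (sym c′≡b)))) ⟩
  P ℕ.* 1                                                                            ≡⟨ ℕₚ.*-identityʳ P ⟩
  P                                                                                ∎
  where
  open ℕₚ.≤-Reasoning
  eq : ∀ (c : Fin N) (x : Fin P) → toℕ (combine c x) ≡ toℕ c ℕ.* P ℕ.+ toℕ x
  eq c x = trans (Finₚ.toℕ-combine c x) (cong (ℕ._+ toℕ x) (ℕₚ.*-comm P (toℕ c)))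
  block : ∀ (c : Fin N) (x : Fin P) → toℕ (combine c x) ℕ./ P ≡ toℕ c
  block c x = ∈-block⇒/≡ (toℕ c) P _ (ℕₚ.≤-trans (ℕₚ.m≤m+n _ (toℕ x)) (ℕₚ.≤-reflexive (sym (eq c x))))
    (ℕₚ.≤-<-trans (ℕₚ.≤-reflexive (eq c x)) (ℕₚ.+-monoʳ-< (toℕ c ℕ.* P) (Finₚ.toℕ<n x)))

-- Canonical variables per job, time point and block

module Counting (g : ℕ) where
  open Construction g

  V : ℕ
  V = NVars I

  Can : Fin V → Set
  Can i = Canonical I (varOf I i)

  can? : ∀ i → Dec (Can i)
  can? i = canonical? I (varOf I i)

  -- The start time decides the block; a canonical run never leaves the block it starts in.
  block : Fin V → ℕ
  block i = vStart I i ℕ./ P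

  ∑-slots : ∀ (f : Fin n → ℕ → ℕ → ℕ) →
    ∑ (allFin V) (λ i → f (vJob I i) (vStart I i) (vLen I i) ℕ.* ι (can? i)) ≡
    ∑ (allFin n) (λ j → ∑ (allFin L) (λ a → f j (r I j ℕ.+ toℕ a ℕ.* p I j) (p I j)))
  ∑-slots f = trans (∑-lookup (variables I) (λ v → f′ v ℕ.* ι (canonical? I v)))
                    -- `suc (g + suc g)` is `L`, the number of slots.
                    (∑-canonical I (g ℕ.+ suc g) (0<size ∘ cell) (deadline-release ∘ cell) f′)
    where
    f′ : Fin n × ℕ × ℕ → ℕ
    f′ (j , t , q) = f j t q

  ∑-job : ∀ j₀ → ∑ (allFin V) (λ i → ι (vJob I i Fin.≟ j₀) ℕ.* ι (can? i)) ℕ.≤ L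
  ∑-job j₀ = ℕₚ.≤-reflexive (begin
    ∑ (allFin V) (λ i → ι (vJob I i Fin.≟ j₀) ℕ.* ι (can? i))        ≡⟨ ∑-slots (λ j _ _ → ι (j Fin.≟ j₀)) ⟩
    ∑ (allFin n) (λ j → ∑ (allFin L) (λ _ → ι (j Fin.≟ j₀)))       ≡⟨ ∑-cong (allFin n) (λ j → ∑-const {L} (ι (j Fin.≟ j₀))) ⟩
    ∑ (allFin n) (λ j → L ℕ.* ι (j Fin.≟ j₀))                        ≡⟨ ∑-*ˡ L (allFin n) (λ j → ι (j Fin.≟ j₀)) ⟩
    L ℕ.* ∑ (allFin n) (λ j → ι (j Fin.≟ j₀))                        ≡⟨ cong (L ℕ.*_) (ι-≟-sum j₀) ⟩
    L ℕ.* 1                                                          ≡⟨ ℕₚ.*-identityʳ L ⟩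
    L                                                              ∎)
    where open ≡-Reasoning

  -- A time point lies in at most one slot of each of the `h` long jobs and in at most one cell,
  -- hence in at most one slot of each of `h` unit jobs; h + h is `L`.
  ∑-time : ∀ t → ∑ (allFin V) (λ i → ι (covers? (vStart I i) (vLen I i) t) ℕ.* ι (can? i)) ℕ.≤ L
  ∑-time t = begin
    ∑ (allFin V) (λ i → ι (covers? (vStart I i) (vLen I i) t) ℕ.* ι (can? i))  ≡⟨ ∑-slots (λ _ s q → ι (covers? s q t)) ⟩
    ∑ (allFin n) (f ∘ cell)                                                  ≡⟨ ∑-cells f ⟩
    h ℕ.* f nothing ℕ.+ h ℕ.* ∑ (allFin P) (f ∘ just)                              ≤⟨ ℕₚ.+-mono-≤ (ℕₚ.*-monoʳ-≤ h (∑-slots≤1 L 0 P t)) (ℕₚ.*-monoʳ-≤ h unit-cells) ⟩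
    h ℕ.* 1 ℕ.+ h ℕ.* 1                                                            ≡⟨ cong₂ ℕ._+_ (ℕₚ.*-identityʳ h) (ℕₚ.*-identityʳ h) ⟩
    L                                                                        ∎
    where
    open ℕₚ.≤-Reasoning
    f : Maybe (Fin P) → ℕ
    f κ = ∑ (allFin L) (λ a → ι (covers? (release κ ℕ.+ toℕ a ℕ.* size κ) (size κ) t))
    perCell : ∀ W → f (just W) ℕ.≤ ι (covers? (toℕ W ℕ.* L) L t)
    perCell W = go (covers? (toℕ W ℕ.* L) L t)
      where
      go : (c? : Dec (Covers (toℕ W ℕ.* L) L t)) → f (just W) ℕ.≤ ι c?
      go (yes _) = ∑-slots≤1 L (toℕ W ℕ.* L) 1 t
      go (no ¬c) = ℕₚ.≤-reflexive (trans (∑-cong (allFin L) (λ a → ι-false (covers? (toℕ W ℕ.* L ℕ.+ toℕ a ℕ.* 1) 1 t) (λ (lo , hi) → ¬c (outer a lo hi)))) (∑-zero (allFin L)))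
        where
        outer : ∀ (a : Fin L) → toℕ W ℕ.* L ℕ.+ toℕ a ℕ.* 1 ℕ.< t → t ℕ.≤ toℕ W ℕ.* L ℕ.+ toℕ a ℕ.* 1 ℕ.+ 1 → Covers (toℕ W ℕ.* L) L t
        outer a lo hi = ℕₚ.≤-<-trans (ℕₚ.m≤m+n _ _) lo , (begin
          t                                  ≤⟨ hi ⟩
          toℕ W ℕ.* L ℕ.+ toℕ a ℕ.* 1 ℕ.+ 1          ≡⟨ eq (toℕ W ℕ.* L) (toℕ a) ⟩
          toℕ W ℕ.* L ℕ.+ suc (toℕ a)            ≤⟨ ℕₚ.+-monoʳ-≤ (toℕ W ℕ.* L) (Finₚ.toℕ<n a) ⟩
          toℕ W ℕ.* L ℕ.+ L                      ∎)
          where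
          eq : ∀ x a → x ℕ.+ a ℕ.* 1 ℕ.+ 1 ≡ x ℕ.+ suc a
          eq = ℕSolver.solve-∀
    unit-cells : ∑ (allFin P) (f ∘ just) ℕ.≤ 1
    -- The cells themselves form aligned slots of length `L`, so at most one covers `t`.
    unit-cells = ℕₚ.≤-trans (∑-mono (allFin P) perCell) (∑-slots≤1 P 0 L t)

  ∑-volume : ∑ (allFin V) (λ i → vLen I i ℕ.* ι (can? i)) ≡ L ℕ.* T
  ∑-volume = begin
    ∑ (allFin V) (λ i → vLen I i ℕ.* ι (can? i))      ≡⟨ ∑-slots (λ _ _ q → q) ⟩
    ∑ (allFin n) (λ j → ∑ (allFin L) (λ _ → p I j)) ≡⟨ ∑-cong (allFin n) (λ j → ∑-const {L} (p I j)) ⟩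
    ∑ (allFin n) (λ j → L ℕ.* p I j)                  ≡⟨ ∑-*ˡ L (allFin n) (p I) ⟩
    L ℕ.* ∑ (allFin n) (p I)                          ≡⟨ cong (L ℕ.*_) (trans (sym (∑-foldr (allFin n) (p I))) totalSize≡T) ⟩
    L ℕ.* T                                           ∎
    where open ≡-Reasoning

  -- The job has `L` slots of length at most `P`.
  ∑-job-volume : ∀ j₀ → ∑ (allFin V) (λ i → ι (vJob I i Fin.≟ j₀) ℕ.* vLen I i ℕ.* ι (can? i)) ℕ.≤ T
  ∑-job-volume j₀ = begin
    ∑ (allFin V) (λ i → ι (vJob I i Fin.≟ j₀) ℕ.* vLen I i ℕ.* ι (can? i))      ≡⟨ ∑-slots (λ j _ q → ι (j Fin.≟ j₀) ℕ.* q) ⟩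
    ∑ (allFin n) (λ j → ∑ (allFin L) (λ _ → ι (j Fin.≟ j₀) ℕ.* p I j))        ≡⟨ ∑-cong (allFin n) (λ j → ∑-const {L} (ι (j Fin.≟ j₀) ℕ.* p I j)) ⟩
    ∑ (allFin n) (λ j → L ℕ.* (ι (j Fin.≟ j₀) ℕ.* p I j))                       ≤⟨ ∑-mono (allFin n) (λ j → ℕₚ.*-monoʳ-≤ L (ℕₚ.*-monoʳ-≤ (ι (j Fin.≟ j₀)) (size≤P (cell j)))) ⟩
    ∑ (allFin n) (λ j → L ℕ.* (ι (j Fin.≟ j₀) ℕ.* P))                           ≡⟨ ∑-cong (allFin n) (λ j → eq L (ι (j Fin.≟ j₀)) P) ⟩
    ∑ (allFin n) (λ j → P ℕ.* L ℕ.* ι (j Fin.≟ j₀))                             ≡⟨ ∑-*ˡ (P ℕ.* L) (allFin n) (λ j → ι (j Fin.≟ j₀)) ⟩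
    P ℕ.* L ℕ.* ∑ (allFin n) (λ j → ι (j Fin.≟ j₀))                             ≡⟨ trans (cong (P ℕ.* L ℕ.*_) (ι-≟-sum j₀)) (ℕₚ.*-identityʳ (P ℕ.* L)) ⟩
    T                                                                       ∎
    where
    open ℕₚ.≤-Reasoning
    eq : ∀ a b c → a ℕ.* (b ℕ.* c) ≡ c ℕ.* a ℕ.* b
    eq = ℕSolver.solve-∀

  -- A block holds at most one slot of each of the `h` long jobs, of length `P`, and at most `P`
  -- unit positions, each open to the `h` unit jobs of its cell: hP + hP = T.
  ∑-block-volume : ∀ b → ∑ (allFin V) (λ i → ι (block i ℕ.≟ b) ℕ.* vLen I i ℕ.* ι (can? i)) ℕ.≤ T
  ∑-block-volume b = begin
    ∑ (allFin V) (λ i → ι (block i ℕ.≟ b) ℕ.* vLen I i ℕ.* ι (can? i))    ≡⟨ ∑-slots (λ _ t q → ι (t ℕ./ P ℕ.≟ b) ℕ.* q) ⟩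
    ∑ (allFin n) (f ∘ cell)                                           ≡⟨ ∑-cells f ⟩
    h ℕ.* f nothing ℕ.+ h ℕ.* ∑ (allFin P) (f ∘ just)                       ≤⟨ ℕₚ.+-mono-≤ (ℕₚ.*-monoʳ-≤ h long-slots) (ℕₚ.*-monoʳ-≤ h unit-slots) ⟩
    h ℕ.* P ℕ.+ h ℕ.* P                                                     ≡⟨ eq h P ⟩
    T                                                                 ∎
    where
    open ℕₚ.≤-Reasoning
    eq : ∀ h P → h ℕ.* P ℕ.+ h ℕ.* P ≡ P ℕ.* (h ℕ.+ h)
    eq = ℕSolver.solve-∀
    f : Maybe (Fin P) → ℕ
    f κ = ∑ (allFin L) (λ a → ι ((release κ ℕ.+ toℕ a ℕ.* size κ) ℕ./ P ℕ.≟ b) ℕ.* size κ)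
    long-slots : f nothing ℕ.≤ P
    long-slots = begin
      ∑ (allFin L) (λ a → ι (toℕ a ℕ.* P ℕ./ P ℕ.≟ b) ℕ.* P)       ≡⟨ ∑-cong (allFin L) (λ a → trans (ℕₚ.*-comm _ P) (cong (λ q → P ℕ.* ι (q ℕ.≟ b)) (m*n/n≡m (toℕ a) P))) ⟩
      ∑ (allFin L) (λ a → P ℕ.* ι (toℕ a ℕ.≟ b))                 ≡⟨ ∑-*ˡ P (allFin L) (λ a → ι (toℕ a ℕ.≟ b)) ⟩
      P ℕ.* ∑ (allFin L) (λ a → ι (toℕ a ℕ.≟ b))                 ≤⟨ ℕₚ.*-monoʳ-≤ P (∑-ι≤1 (λ c → toℕ c ℕ.≟ b) (allFin⁺ L) (λ c≡b c′≡b → Finₚ.toℕ-injective (trans c≡b (sym c′≡b)))) ⟩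
      P ℕ.* 1                                                    ≡⟨ ℕₚ.*-identityʳ P ⟩
      P                                                        ∎
    unit-slots : ∑ (allFin P) (f ∘ just) ℕ.≤ P
    unit-slots = begin
      ∑ (allFin P) (λ W → ∑ (allFin L) (λ a → ι ((toℕ W ℕ.* L ℕ.+ toℕ a ℕ.* 1) ℕ./ P ℕ.≟ b) ℕ.* 1))
        -- Running over cells and offsets lists every start below `P * L` once.
        ≡⟨ ∑-cong (allFin P) (λ W → ∑-cong (allFin L) (λ a → trans (ℕₚ.*-identityʳ _) (cong (λ u → ι (u ℕ./ P ℕ.≟ b)) (position W a)))) ⟩
      ∑ (allFin P) (λ W → ∑ (allFin L) (λ a → ι (toℕ (combine W a) ℕ./ P ℕ.≟ b)))
        ≡⟨ ∑-Fin-* P L (λ u → ι (toℕ u ℕ./ P ℕ.≟ b)) ⟨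
      ∑ (allFin (P ℕ.* L)) (λ u → ι (toℕ u ℕ./ P ℕ.≟ b))
        ≡⟨ ∑-upTo-allFin (P ℕ.* L) (λ u → ι (u ℕ./ P ℕ.≟ b)) ⟨
      ∑ (upTo (P ℕ.* L)) (λ u → ι (u ℕ./ P ℕ.≟ b))
        ≡⟨ cong (λ m → ∑ (upTo m) (λ u → ι (u ℕ./ P ℕ.≟ b))) (ℕₚ.*-comm P L) ⟩
      ∑ (upTo (L ℕ.* P)) (λ u → ι (u ℕ./ P ℕ.≟ b))
        ≤⟨ ∑-block≤ L P b ⟩
      P ∎
      where
      position : ∀ (W : Fin P) (a : Fin L) → toℕ W ℕ.* L ℕ.+ toℕ a ℕ.* 1 ≡ toℕ (combine W a)
      position W a = trans (cong₂ ℕ._+_ (ℕₚ.*-comm (toℕ W) L) (ℕₚ.*-identityʳ (toℕ a))) (sym (Finₚ.toℕ-combine W a))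

  -- A unit slot covers a single point, and a long slot is itself a block. The covered time is
  -- written `suc u` because slots are open on the left, so that `u` falls in the block of the
  -- start.
  covered-block : ∀ κ {t q u} → q ≡ size κ → size κ Div.∣ t ℕ.∸ release κ → Covers t q (suc u) → t ℕ./ P ≡ u ℕ./ P
  covered-block (just W) {t} {u = u} refl _ (s≤s t≤u , u<t+1) =
    cong (λ v → v ℕ./ P) (ℕₚ.≤-antisym t≤u (ℕₚ.≤-pred (ℕₚ.≤-trans u<t+1 (ℕₚ.≤-reflexive (ℕₚ.+-comm t 1)))))
  covered-block nothing {u = u} refl (Div.divides a refl) (s≤s t≤u , u<t+P) =
    trans (m*n/n≡m a P) (sym (∈-block⇒/≡ a P u t≤u u<t+P))

-- The lifted solution

finEqℚ≡ι : ∀ {n} (a b : Fin n) → finEqℚ a b ≡ ℕtoℚ (ι (a Fin.≟ b))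
finEqℚ≡ι a b with a Fin.≟ b
... | yes _ = refl
... | no  _ = refl

coversℚ≡ι : ∀ t q t′ → coversℚ t q t′ ≡ ℕtoℚ (ι (covers? t q t′))
coversℚ≡ι t q t′ with t ℕ.<? t′ | t′ ℕ.≤? t ℕ.+ q
... | yes _ | yes _ = refl
... | yes _ | no _  = refl
... | no _  | yes _ = refl
... | no _  | no _  = refl

-- The equation says ρ(suc l + k) = 1. It makes a clique of `suc l` candidates weigh exactly the
-- Bonferroni factor, as `lifted-clique` requires.
ρ-exists : ∀ l k → ∃ λ ρ → 0ℚ ≤ ρ × ρ * ℕtoℚ (suc l) ≡ 1ℚ - ℕtoℚ k * ρ
ρ-exists l k = ρ , nonNegative⁻¹ ρ {{normalize-nonNeg 1 (suc l ℕ.+ k)}} , (begin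
  ρ * ℕtoℚ (suc l)                                 ≡⟨ shift ρ (ℕtoℚ (suc l)) (ℕtoℚ k) ⟩
  ρ * (ℕtoℚ (suc l) + ℕtoℚ k) - ℕtoℚ k * ρ         ≡⟨ cong (λ t → ρ * t - ℕtoℚ k * ρ) (sym (ℕtoℚ-homo-+ (suc l) k)) ⟩
  ρ * ℕtoℚ (suc l ℕ.+ k) - ℕtoℚ k * ρ              ≡⟨ cong (_- ℕtoℚ k * ρ) (/-*-denominator 1 (l ℕ.+ k)) ⟩
  1ℚ - ℕtoℚ k * ρ                                  ∎)
  where
  open ≡-Reasoning
  open +-*-Solver
  ρ = + 1 / (suc l ℕ.+ k)
  shift : ∀ ρ a b → ρ * a ≡ ρ * (a + b) - b * ρ
  shift = solve 3 (λ ρ a b → ρ :* a := ρ :* (a :+ b) :- b :* ρ) refl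

-- The budget estimate

-‿*-distrib : ∀ ε t → - (ε * t - t) ≡ (1ℚ - ε) * t
-‿*-distrib = solve 2 (λ ε τ → :- (ε :* τ :- τ) := (con 1ℚ :- ε) :* τ) refl
  where open +-*-Solver

module _ (L T k : ℕ) (ρ ε : ℚ) (0≤ρ : 0ℚ ≤ ρ) (ρL : ρ * ℕtoℚ L ≡ 1ℚ - ℕtoℚ k * ρ)
         (0≤ε : 0ℚ ≤ ε) (4k≤εL : ℕtoℚ (4 ℕ.* k) ≤ ε * ℕtoℚ L) where

  private
    κ τ : ℚ
    κ = ℕtoℚ k * ρ
    τ = ℕtoℚ T

  0≤κ : 0ℚ ≤ κ
  0≤κ = 0≤* (0≤ℕtoℚ k) 0≤ρ

  4κ≤ε : ℕtoℚ 4 * κ ≤ ε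
  4κ≤ε = begin
    ℕtoℚ 4 * (ℕtoℚ k * ρ)       ≡⟨ sym (*-assoc (ℕtoℚ 4) (ℕtoℚ k) ρ) ⟩
    ℕtoℚ 4 * ℕtoℚ k * ρ         ≡⟨ cong (_* ρ) (sym (ℕtoℚ-homo-* 4 k)) ⟩
    ℕtoℚ (4 ℕ.* k) * ρ          ≤⟨ *-monoʳ-≤-0≤ 0≤ρ 4k≤εL ⟩
    ε * ℕtoℚ L * ρ              ≡⟨ trans (*-assoc ε (ℕtoℚ L) ρ) (cong (ε *_) (trans (*-comm (ℕtoℚ L) ρ) ρL)) ⟩
    ε * (1ℚ - κ)                ≤⟨ *-monoˡ-≤-0≤ 0≤ε (p-q≤p 0≤κ) ⟩
    ε * 1ℚ                      ≡⟨ *-identityʳ ε ⟩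
    ε                           ∎
    where open ≤-Reasoning

  -- The right side is (1 - κ)(1 - 3κ)τ: one factor is Bonferroni, the other is ρL = 1 - κ less the
  -- 2κ that `k` elements rule out. It equals (1 - 4κ + 3κ²)τ, and 4κ ≤ ε.
  scheduled≥ : (1ℚ - ε) * τ ≤ (1ℚ - κ) * (ρ * (ℕtoℚ (L ℕ.* T) - ℕtoℚ (k ℕ.* (T ℕ.+ T))))
  scheduled≥ = begin
    (1ℚ - ε) * τ                                                   ≤⟨ *-monoʳ-≤-0≤ (0≤ℕtoℚ T) (0≤q-p⇒p≤q {1ℚ - ε} {(1ℚ - κ) * (1ℚ - κ - (κ + κ))} 0≤gap) ⟩
    (1ℚ - κ) * (1ℚ - κ - (κ + κ)) * τ                              ≡⟨ cong (λ t → (1ℚ - κ) * (t - (κ + κ)) * τ) (sym ρL) ⟩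
    (1ℚ - κ) * (ρ * ℕtoℚ L - (ℕtoℚ k * ρ + ℕtoℚ k * ρ)) * τ        ≡⟨ regroup (1ℚ - κ) ρ (ℕtoℚ L) (ℕtoℚ k) τ ⟩
    (1ℚ - κ) * (ρ * (ℕtoℚ L * τ - ℕtoℚ k * (τ + τ)))               ≡⟨ cong₂ (λ a b → (1ℚ - κ) * (ρ * (a - b))) (sym (ℕtoℚ-homo-* L T)) (sym (trans (ℕtoℚ-homo-* k (T ℕ.+ T)) (cong (ℕtoℚ k *_) (ℕtoℚ-homo-+ T T)))) ⟩
    (1ℚ - κ) * (ρ * (ℕtoℚ (L ℕ.* T) - ℕtoℚ (k ℕ.* (T ℕ.+ T))))            ∎
    where
    open ≤-Reasoning
    open +-*-Solver
    regroup : ∀ θ ρ l k τ → θ * (ρ * l - (k * ρ + k * ρ)) * τ ≡ θ * (ρ * (l * τ - k * (τ + τ)))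
    regroup = solve 5 (λ θ ρ l k τ → θ :* (ρ :* l :- (k :* ρ :+ k :* ρ)) :* τ := θ :* (ρ :* (l :* τ :- k :* (τ :+ τ)))) refl
    gap : ∀ κ ε → (1ℚ - κ) * (1ℚ - κ - (κ + κ)) - (1ℚ - ε) ≡ (ε - ℕtoℚ 4 * κ) + ℕtoℚ 3 * (κ * κ)
    gap = solve 2 (λ κ ε → (con 1ℚ :- κ) :* (con 1ℚ :- κ :- (κ :+ κ)) :- (con 1ℚ :- ε) := (ε :- con (ℕtoℚ 4) :* κ) :+ con (ℕtoℚ 3) :* (κ :* κ)) refl
    0≤gap : 0ℚ ≤ (1ℚ - κ) * (1ℚ - κ - (κ + κ)) - (1ℚ - ε)
    0≤gap = subst (0ℚ ≤_) (sym (gap κ ε)) (0≤+ (p≤q⇒0≤q-p 4κ≤ε) (0≤* (0≤ℕtoℚ 3) (0≤* 0≤κ 0≤κ)))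

-- What the lifted solution uses of the instance; the concrete cells and sizes stay out of the
-- Sherali-Adams argument.
record Balanced {n} (I : Instance n) (L : ℕ) : Set where
  field
    block         : Fin (NVars I) → ℕ
    covered-block : ∀ {i i′} u → Canonical I (varOf I i) → Canonical I (varOf I i′) →
                    Covers (vStart I i) (vLen I i) (suc u) → Covers (vStart I i′) (vLen I i′) (suc u) → block i ≡ block i′
    ∑-job         : ∀ j → ∑ (allFin (NVars I)) (λ i → ι (vJob I i Fin.≟ j) ℕ.* ι (canonical? I (varOf I i))) ℕ.≤ L
    ∑-time        : ∀ t → ∑ (allFin (NVars I)) (λ i → ι (covers? (vStart I i) (vLen I i) t) ℕ.* ι (canonical? I (varOf I i))) ℕ.≤ L
    ∑-volume      : ∑ (allFin (NVars I)) (λ i → vLen I i ℕ.* ι (canonical? I (varOf I i))) ≡ L ℕ.* totalSize I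
    ∑-job-volume  : ∀ j → ∑ (allFin (NVars I)) (λ i → ι (vJob I i Fin.≟ j) ℕ.* vLen I i ℕ.* ι (canonical? I (varOf I i))) ℕ.≤ totalSize I
    ∑-block-volume : ∀ b → ∑ (allFin (NVars I)) (λ i → ι (block i ℕ.≟ b) ℕ.* vLen I i ℕ.* ι (canonical? I (varOf I i))) ℕ.≤ totalSize I

module LocalSolution {n} (I : Instance n) (L : ℕ) (bal : Balanced I L)
  (k : ℕ) (ρ : ℚ) (0≤ρ : 0ℚ ≤ ρ) (ρL : ρ * ℕtoℚ L ≡ 1ℚ - ℕtoℚ k * ρ) where

  open Balanced bal

  V T : ℕ
  V = NVars I
  T = totalSize I

  Can : Fin V → Set
  Can i = Canonical I (varOf I i)

  can? : ∀ i → Dec (Can i)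
  can? i = canonical? I (varOf I i)

  -- Sharing a job makes the job constraints cliques, sharing a block the time constraints. Blocks
  -- are coarser than overlap, yet one block still carries canonical length at most `T`.
  _#_ : Fin V → Fin V → Set
  i # j = vJob I i ≡ vJob I j ⊎ block i ≡ block j

  _#?_ : ∀ i j → Dec (i # j)
  i #? j = vJob I i Fin.≟ vJob I j ⊎-dec block i ℕ.≟ block j

  0≤θ : 0ℚ ≤ 1ℚ - ℕtoℚ k * ρ
  0≤θ = subst (0ℚ ≤_) ρL (0≤* 0≤ρ (0≤ℕtoℚ L))

  open IndependentSets Can can? _#_ _#?_ (Sum.map sym sym) ρ 0≤ρ
  open Rounds k 0≤θ

  D≤θ : ρ * ℕtoℚ L ≤ θ
  D≤θ = ≤-reflexive ρL

  -- The two indicators are added, not joined: the sum is still at least 1 on conflicts, and it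
  -- splits into a count by job and a count by block, each of length at most `T`.
  excess : Fin V → Fin V → ℕ
  excess s i = ι (vJob I i Fin.≟ vJob I s) ℕ.+ ι (block i ℕ.≟ block s)

  excess-# : ∀ s i → i # s → 1 ℕ.≤ excess s i
  excess-# s i (inj₁ eq) = ℕₚ.≤-trans (ℕₚ.≤-reflexive (sym (ι-true (vJob I i Fin.≟ vJob I s) eq))) (ℕₚ.m≤m+n _ _)
  excess-# s i (inj₂ eq) = ℕₚ.≤-trans (ℕₚ.≤-reflexive (sym (ι-true (block i ℕ.≟ block s) eq))) (ℕₚ.m≤n+m _ _)

  ∑-excess : ∀ s → ∑ (allFin V) (λ i → excess s i ℕ.* (vLen I i ℕ.* ι (can? i))) ℕ.≤ T ℕ.+ T
  ∑-excess s = begin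
    ∑ (allFin V) (λ i → excess s i ℕ.* (vLen I i ℕ.* ι (can? i)))
      ≡⟨ ∑-cong (allFin V) (λ i → expand (ι (vJob I i Fin.≟ vJob I s)) (ι (block i ℕ.≟ block s)) (vLen I i) (ι (can? i))) ⟩
    ∑ (allFin V) (λ i → ι (vJob I i Fin.≟ vJob I s) ℕ.* vLen I i ℕ.* ι (can? i) ℕ.+ ι (block i ℕ.≟ block s) ℕ.* vLen I i ℕ.* ι (can? i))
      ≡⟨ ∑-+ (allFin V) (λ i → ι (vJob I i Fin.≟ vJob I s) ℕ.* vLen I i ℕ.* ι (can? i)) (λ i → ι (block i ℕ.≟ block s) ℕ.* vLen I i ℕ.* ι (can? i)) ⟩
    ∑ (allFin V) (λ i → ι (vJob I i Fin.≟ vJob I s) ℕ.* vLen I i ℕ.* ι (can? i)) ℕ.+ ∑ (allFin V) (λ i → ι (block i ℕ.≟ block s) ℕ.* vLen I i ℕ.* ι (can? i))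
      ≤⟨ ℕₚ.+-mono-≤ (∑-job-volume (vJob I s)) (∑-block-volume (block s)) ⟩
    T ℕ.+ T ∎
    where
    open ℕₚ.≤-Reasoning
    expand : ∀ a b l c → (a ℕ.+ b) ℕ.* (l ℕ.* c) ≡ a ℕ.* l ℕ.* c ℕ.+ b ℕ.* l ℕ.* c
    expand = ℕSolver.solve-∀

  module _ (ε : ℚ) (ε≤1 : ε ≤ 1ℚ) (4k≤εL : ℕtoℚ (4 ℕ.* k) ≤ ε * ℕtoℚ L) (0≤ε : 0ℚ ≤ ε) where

    rhs : ℚ
    rhs = ε * ℕtoℚ (totalSize I) - ℕtoℚ (totalSize I)

    -rhs : - rhs ≡ (1ℚ - ε) * ℕtoℚ T
    -rhs = -‿*-distrib ε (ℕtoℚ T)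

    0≤-rhs : 0ℚ ≤ - rhs
    0≤-rhs = subst (0ℚ ≤_) (sym -rhs) (0≤* (p≤q⇒0≤q-p ε≤1) (0≤ℕtoℚ T))

    -rhs≤ : - rhs ≤ θ * (ρ * (ℕtoℚ (L ℕ.* T) - ℕtoℚ (k ℕ.* (T ℕ.+ T))))
    -rhs≤ = ≤-trans (≤-reflexive -rhs) (scheduled≥ L T k ρ ε 0≤ρ ρL 0≤ε 4k≤εL)

    Satisfied : Constraint V → Set
    Satisfied c = ∀ S R → ∣ S ∣ ℕ.+ ∣ R ∣ ℕ.≤ k → liftedLHS c y S R ≤ 0ℚ

    R≤k : ∀ (S R : Subset V) → ∣ S ∣ ℕ.+ ∣ R ∣ ℕ.≤ k → ∣ R ∣ ℕ.≤ k
    R≤k S R = ℕₚ.≤-trans (ℕₚ.m≤n+m ∣ R ∣ ∣ S ∣)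

    budget : Satisfied ((λ i → - ℕtoℚ (vLen I i)) , rhs)
    budget S R = lifted-budget (vLen I) excess (L ℕ.* T) (T ℕ.+ T) rhs
      (λ i → excess-# i i (inj₁ refl)) excess-# (ℕₚ.≤-reflexive (sym ∑-volume)) ∑-excess
      0≤-rhs -rhs≤ {S} {R}

    jobs : ∀ j → Satisfied ((λ i → finEqℚ (vJob I i) j) , 1ℚ)
    jobs j S R SR≤k = lifted-clique (λ i → vJob I i Fin.≟ j) _ L (λ i → finEqℚ≡ι (vJob I i) j)
      (λ i i′ eq eq′ _ _ → inj₁ (trans eq (sym eq′))) (∑-job j) D≤θ {S} {R} (R≤k S R SR≤k)

    times : ∀ u → Satisfied ((λ i → coversℚ (vStart I i) (vLen I i) (suc u)) , 1ℚ)
    times u S R SR≤k = lifted-clique (λ i → covers? (vStart I i) (vLen I i) (suc u)) _ L (λ i → coversℚ≡ι (vStart I i) (vLen I i) (suc u))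
      (λ i i′ cov cov′ can can′ → inj₂ (covered-block u can can′ cov cov′)) (∑-time (suc u)) D≤θ {S} {R} (R≤k S R SR≤k)

    nonnegs : ∀ i₀ → Satisfied ((λ i → - finEqℚ i i₀) , 0ℚ)
    nonnegs i₀ S R SR≤k = lifted-nonneg (λ i → finEqℚ i i₀) (λ i → subst (0ℚ ≤_) (sym (finEqℚ≡ι i i₀)) (0≤ℕtoℚ (ι (i Fin.≟ i₀)))) {S} {R} (R≤k S R SR≤k)

    all-satisfied : All Satisfied (LP I (ε * ℕtoℚ (totalSize I)))
    all-satisfied = budget ∷ Allₚ.++⁺ (Allₚ.map⁺ (All.universal jobs (allFin n)))
      (Allₚ.++⁺ (Allₚ.map⁺ (All.universal times (upTo (totalSize I)))) (Allₚ.map⁺ (All.universal nonnegs (allFin V))))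

    sherali-adams : SANonempty (LP I (ε * ℕtoℚ (totalSize I))) k
    -- Level `k` asks for |S| + |R| < k, while the estimates hold up to `k`.
    sherali-adams = y , y-⊥ , λ c S R SR<k → All.lookup all-satisfied (∈-lookup c) S R (ℕₚ.<⇒≤ SR<k)

balanced : ∀ g → Balanced (Construction.I g) (Construction.L g)
balanced g = record
  { block          = block
  ; covered-block  = λ {i} {i′} u can can′ cov cov′ →
      trans (covered-block (cell (vJob I i)) (proj₁ can) (proj₂ can) cov)
            (sym (covered-block (cell (vJob I i′)) (proj₁ can′) (proj₂ can′) cov′))
  ; ∑-job          = ∑-job
  ; ∑-time         = ∑-time
  ; ∑-volume       = trans ∑-volume (cong (L ℕ.*_) (sym totalSize≡T))
  ; ∑-job-volume   = λ j → ℕₚ.≤-trans (∑-job-volume j) (ℕₚ.≤-reflexive (sym totalSize≡T))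
  ; ∑-block-volume = λ b → ℕₚ.≤-trans (∑-block-volume b) (ℕₚ.≤-reflexive (sym totalSize≡T))
  }
  where
  open Construction g
  open Counting g

-- The level against the number of jobs

n≤2^n : ∀ n → n ℕ.≤ 2 ^ n
n≤2^n zero    = z≤n
n≤2^n (suc n) = ℕₚ.≤-trans (s≤s (n≤2^n n)) (ℕₚ.+-mono-≤ (ℕₚ.m^n>0 2 n) (ℕₚ.m≤m+n (2 ^ n) 0))

^-cancelˡ-≤ : ∀ a b → 2 ^ a ℕ.≤ 2 ^ b → a ℕ.≤ b
^-cancelˡ-≤ a b le = ℕₚ.≮⇒≥ λ b<a → ℕₚ.<⇒≱ (ℕₚ.^-monoʳ-< 2 (s≤s (s≤s z≤n)) b<a) le

-- There are at most 21h² jobs, where 21 ≤ 2^5 and h ≤ 2^h. A linear bound on the logarithm is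
-- enough, since `L` is linear in h.
jobs≤2^ : ∀ g → Construction.n g ℕ.≤ 2 ^ (7 ℕ.* suc g)
jobs≤2^ g = begin
  h ℕ.+ 10 ℕ.* (h ℕ.+ h) ℕ.* h              ≤⟨ ℕₚ.+-monoˡ-≤ _ (ℕₚ.m≤m*n h h) ⟩
  h ℕ.* h ℕ.+ 10 ℕ.* (h ℕ.+ h) ℕ.* h        ≡⟨ eq h ⟩
  21 ℕ.* (h ℕ.* h)                          ≤⟨ ℕₚ.*-mono-≤ (ℕₚ.m≤m+n 21 11) (ℕₚ.*-mono-≤ (n≤2^n h) (n≤2^n h)) ⟩
  2 ^ 5 ℕ.* (2 ^ h ℕ.* 2 ^ h)               ≡⟨ trans (cong (2 ^ 5 ℕ.*_) (sym (ℕₚ.^-distribˡ-+-* 2 h h))) (sym (ℕₚ.^-distribˡ-+-* 2 5 (h ℕ.+ h))) ⟩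
  2 ^ (5 ℕ.+ (h ℕ.+ h))                     ≤⟨ ℕₚ.^-monoʳ-≤ 2 (ℕₚ.≤-trans (ℕₚ.+-monoˡ-≤ (h ℕ.+ h) (ℕₚ.m≤m*n 5 h)) (ℕₚ.≤-reflexive (eq′ h))) ⟩
  2 ^ (7 ℕ.* h)                             ∎
  where
  open ℕₚ.≤-Reasoning
  h = suc g
  eq : ∀ h → h ℕ.* h ℕ.+ 10 ℕ.* (h ℕ.+ h) ℕ.* h ≡ 21 ℕ.* (h ℕ.* h)
  eq = ℕSolver.solve-∀
  eq′ : ∀ h → 5 ℕ.* h ℕ.+ (h ℕ.+ h) ≡ 7 ℕ.* h
  eq′ = ℕSolver.solve-∀

-- For q = a/d the floor gives 2^(kd) ≤ m^a ≤ 2^(Ha), and comparing exponents gives kd ≤ Ha.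
floor-log-bound : ∀ q .{{_ : Positive q}} m H k → m ℕ.≤ 2 ^ H → IsFloorMulLog₂ q m k → ℕtoℚ k ≤ ℕtoℚ H * q
floor-log-bound q@(mkℚ (+[1+ a ]) d-1 _) m H k m≤2^H (2^kd≤ , _) =
  *-cancelʳ-≤-pos (ℕtoℚ (suc d-1)) {{normalize-pos (suc d-1) 1}} (begin
    ℕtoℚ k * ℕtoℚ (suc d-1)                ≡⟨ ℕtoℚ-homo-* k (suc d-1) ⟨
    ℕtoℚ (k ℕ.* suc d-1)                   ≤⟨ ℕtoℚ-mono-≤ (^-cancelˡ-≤ (k ℕ.* suc d-1) (H ℕ.* suc a) (ℕₚ.≤-trans 2^kd≤ (ℕₚ.≤-trans (ℕₚ.^-monoˡ-≤ (suc a) m≤2^H) (ℕₚ.≤-reflexive (ℕₚ.^-*-assoc 2 H (suc a)))))) ⟩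
    ℕtoℚ (H ℕ.* suc a)                     ≡⟨ ℕtoℚ-homo-* H (suc a) ⟩
    ℕtoℚ H * ℕtoℚ (suc a)                  ≡⟨ cong (ℕtoℚ H *_) (sym (trans (cong (_* ℕtoℚ (suc d-1)) (sym (↥p/↧p≡p q))) (/-*-denominator (suc a) d-1))) ⟩
    ℕtoℚ H * (q * ℕtoℚ (suc d-1))          ≡⟨ sym (*-assoc (ℕtoℚ H) q (ℕtoℚ (suc d-1))) ⟩
    ℕtoℚ H * q * ℕtoℚ (suc d-1)            ∎)
  where open ≤-Reasoning

-- The constant c. The level is at most 7hcε and four times it must not exceed 2hε, so any positive
-- c up to 1/14 fits; 1/20 leaves (3/5)εh, the term in `slack`.
1/20 : ℚ
1/20 = + 1 / 20

4k≤εL : ∀ ε h k → 0ℚ ≤ ε → ℕtoℚ k ≤ ℕtoℚ (7 ℕ.* h) * (1/20 * ε) → ℕtoℚ (4 ℕ.* k) ≤ ε * ℕtoℚ (h ℕ.+ h)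
4k≤εL ε h k 0≤ε k≤ = begin
  ℕtoℚ (4 ℕ.* k)                                     ≡⟨ ℕtoℚ-homo-* 4 k ⟩
  ℕtoℚ 4 * ℕtoℚ k                                    ≤⟨ *-monoˡ-≤-0≤ (0≤ℕtoℚ 4) k≤ ⟩
  ℕtoℚ 4 * (ℕtoℚ (7 ℕ.* h) * (1/20 * ε))             ≡⟨ cong (λ t → ℕtoℚ 4 * (t * (1/20 * ε))) (ℕtoℚ-homo-* 7 h) ⟩
  ℕtoℚ 4 * (ℕtoℚ 7 * ℕtoℚ h * (1/20 * ε))            ≤⟨ 0≤q-p⇒p≤q {ℕtoℚ 4 * (ℕtoℚ 7 * ℕtoℚ h * (1/20 * ε))} {ε * (ℕtoℚ h + ℕtoℚ h)} (subst (0ℚ ≤_) (sym (slack ε (ℕtoℚ h))) (0≤* (nonNegative⁻¹ (+ 3 / 5)) (0≤* 0≤ε (0≤ℕtoℚ h)))) ⟩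
  ε * (ℕtoℚ h + ℕtoℚ h)                              ≡⟨ cong (ε *_) (sym (ℕtoℚ-homo-+ h h)) ⟩
  ε * ℕtoℚ (h ℕ.+ h)                                 ∎
  where
  open ≤-Reasoning
  open +-*-Solver
  slack : ∀ ε h → ε * (h + h) - ℕtoℚ 4 * (ℕtoℚ 7 * h * (1/20 * ε)) ≡ + 3 / 5 * (ε * h)
  slack = solve 2 (λ ε h → ε :* (h :+ h) :- con (ℕtoℚ 4) :* (con (ℕtoℚ 7) :* h :* (con 1/20 :* ε)) := con (+ 3 / 5) :* (ε :* h)) refl

theorem6 : ∃ λ (c : ℚ) → Positive c ×
    ∃ λ (ε₀ : ℚ) → Positive ε₀ ×
    ∀ (ε : ℚ) → Positive ε → ε ℚ.< ε₀ →
    InfinitelyMany (λ n → (0 ℕ.< n) ×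
    ∃ λ (I : Instance n) →
    ValidInstance I ×
    (totalSize I ≡ maxDeadline I) ×
    (∀ (s : Solution I) → totalSize I ℕ.≤ 5 ℕ.* cost s) ×
    (∀ (k : ℕ) → IsFloorMulLog₂ (c ℚ.* ε) n k →
    SANonempty (LP I (ε ℚ.* ℕtoℚ (totalSize I))) k))
-- The bound 1 on ε keeps the length (1 - ε)T that must be scheduled nonnegative. The given `m` is
-- itself the parameter of the construction, since m + 1 = h ≤ n.
theorem6 = 1/20 , _ , 1ℚ , _ , λ ε ε>0 ε<1 m →
  let open Construction m
      0≤ε = nonNegative⁻¹ ε {{pos⇒nonNeg ε {{ε>0}}}}
  in n , ℕₚ.≤-trans (ℕₚ.n≤1+n m) (ℕₚ.m≤m+n h (P ℕ.* h)) , s≤s z≤n , I , valid , trans totalSize≡T (sym maxDeadline≡T) , cost≥ ,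
     -- `ρ` depends on the level, so it is chosen once `k` is known.
     λ k floor → let (ρ , 0≤ρ , ρL) = ρ-exists (m ℕ.+ suc m) k in
       LocalSolution.sherali-adams I L (balanced m) k ρ 0≤ρ ρL ε (<⇒≤ ε<1)
         (4k≤εL ε h k 0≤ε (floor-log-bound (1/20 * ε) {{pos*pos⇒pos 1/20 ε {{ε>0}}}} n (7 ℕ.* h) k (jobs≤2^ m) floor)) 0≤ε
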